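{- Let $G$ be a connected graph of order $n\ge 9$. If $G\not\cong F_n$, then $d(G)\le h(n)$, and equality holds if and only if $G\in\{U_n, T_n\}$ (up to isomorphism), where \[ h(n)=\begin{cases}2^{n-1}+(n+9)\cdot 2^{\frac{n-7}{2}} & n \text{ odd},\\ 2^{n-1}+(n+12)\cdot 2^{\frac{n-8}{2}} & n\text{ even},\end{cases}\qquad F_n=\begin{cases}K_1*\tfrac{n-1}{2}K_2 & n\text{ odd},\\ K_2*\tfrac{n-2}{2}K_2 & n\text{ even},\end{cases}\] \[ U_n=K_3*\Big(\big\lfloor\tfrac{n-3}{2}\big\rfloor K_2\cup \big((n+1)\bmod 2\big)K_1\Big),\qquad T_n=\begin{cases}K_1*\big(2K_1\cup \tfrac{n-3}{2}K_2\big) & n\text{ odd},\\ K_1*\big(3K_1\cup\tfrac{n-4}{2}K_2\big) & n\text{ even}.\end{cases}\]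
   Context: All graphs are finite, simple and undirected. A subset $S$ of vertices of a graph $G$ is a dissociation set if the subgraph induced by $S$ has maximum degree at most one (the empty set is a dissociation set). $d(G)$ denotes the total number of dissociation sets of $G$ (including the empty set). $sK_1\cup tK_2$ denotes the disjoint union of $s$ isolated vertices and $t$ disjoint edges; $0K_1$ means no isolated vertex. The operation $*$: if $H=K_{s_1}\cup\cdots\cup K_{s_t}$ is a disjoint union of complete graphs and $K_r$ is a complete graph disjoint from $H$, then $K_r*H$ is the graph obtained from $K_r\cup H$ by choosing one vertex $u$ of $K_r$ and joining $u$ to exactly one vertex of each component of $H$ (the result is independent of choices up to isomorphism). -}

module Defs where

open import Data.Bool using (Bool; true; false; if_then_else_; _∧_; _∨_; not)
open import Data.Nat using (ℕ; zero; suc; _+_; _*_; _∸_; _^_; _≤_; _<ᵇ_; _≡ᵇ_; _/_; _%_)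
open import Data.Nat.Properties using (_≤?_)
open import Data.Fin using (Fin; toℕ)
open import Data.Fin.Properties using (all?)
open import Data.Fin.Permutation using (Permutation′; _⟨$⟩ʳ_)
open import Data.List using (List; []; _∷_; length; filter; map; _++_; replicate; allFin)
open import Data.Vec using (Vec; []; _∷_; lookup)
open import Data.Maybe using (Maybe; just; nothing)
open import Data.Product using (Σ; _×_; _,_)
open import Relation.Binary.PropositionalEquality using (_≡_)
open import Relation.Nullary using (Dec; yes; no)
open import Relation.Nullary.Decidable using (_→-dec_)

Graph : ℕ → Set
Graph n = Fin n → Fin n → Bool

IsSimple : ∀ {n} → Graph n → Set
IsSimple {n} G = (∀ u v → G u v ≡ G v u) × (∀ u → G u u ≡ false)

data Reach {n} (G : Graph n) (u : Fin n) : Fin n → Set where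
  here : Reach G u u
  step : ∀ {w v} → Reach G u w → G w v ≡ true → Reach G u v

Connected : ∀ {n} → Graph n → Set
Connected {n} G = ∀ (u v : Fin n) → Reach G u v

_≅_ : ∀ {n} → Graph n → Graph n → Set
_≅_ {n} G H = Σ (Permutation′ n) λ σ → ∀ u v → G u v ≡ H (σ ⟨$⟩ʳ u) (σ ⟨$⟩ʳ v)

Subset : ℕ → Set
Subset n = Vec Bool n

degIn : ∀ {n} → Graph n → Subset n → Fin n → ℕ
degIn {n} G S v = length (filter (λ u → lookup S u Data.Bool.≟ true) (filter (λ u → G v u Data.Bool.≟ true) (allFin n)))
  where import Data.Bool

IsDissociation : ∀ {n} → Graph n → Subset n → Set
IsDissociation {n} G S = ∀ (v : Fin n) → lookup S v ≡ true → degIn G S v ≤ 1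

isDissociation? : ∀ {n} (G : Graph n) (S : Subset n) → Dec (IsDissociation G S)
isDissociation? G S = all? (λ v → (lookup S v Data.Bool.≟ true) →-dec (degIn G S v ≤? 1))
  where import Data.Bool

allSubsets : ∀ n → List (Subset n)
allSubsets zero = [] ∷ []
allSubsets (suc n) = map (false ∷_) (allSubsets n) ++ map (true ∷_) (allSubsets n)

d : ∀ {n} → Graph n → ℕ
d {n} G = length (filter (isDissociation? G) (allSubsets n))

-- The construction K_r * (K_{s_1} ∪ ... ∪ K_{s_t}).
-- Vertices are labelled 0 .. r + s_1 + ... + s_t - 1: first the r vertices of
-- K_r (vertex 0 is the distinguished vertex u), then the components in order.
-- u = 0 is joined to the first vertex of each component.

blockOf : List ℕ → ℕ → Maybe (ℕ × Bool)
blockOf [] v = nothing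
blockOf (s ∷ ss) v with v <ᵇ s
... | true = just (0 , (v ≡ᵇ 0))
... | false with blockOf ss (v ∸ s)
...   | nothing = nothing
...   | just (i , f) = just (suc i , f)

centreLink : ℕ → List ℕ → ℕ → ℕ → Bool
centreLink r cs u v with u ≡ᵇ 0 | r <ᵇ suc v
... | true | true with blockOf cs (v ∸ r)
...   | just (_ , f) = f
...   | nothing = false
centreLink r cs u v | _ | _ = false

sameBlock : ℕ → List ℕ → ℕ → ℕ → Bool
sameBlock r cs u v with r <ᵇ suc u | r <ᵇ suc v
... | true | true with blockOf cs (u ∸ r) | blockOf cs (v ∸ r)
...   | just (i , _) | just (j , _) = i ≡ᵇ j
...   | _ | _ = false
sameBlock r cs u v | _ | _ = false

joinAdj : ℕ → List ℕ → ℕ → ℕ → Bool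
joinAdj r cs u v =
  not (u ≡ᵇ v) ∧ (((u <ᵇ r) ∧ (v <ᵇ r)) ∨ sameBlock r cs u v
                  ∨ centreLink r cs u v ∨ centreLink r cs v u)

-- K_r * H on vertex set Fin n (used only when n = r + sum cs)
join : (n r : ℕ) → List ℕ → Graph n
join n r cs i j = joinAdj r cs (toℕ i) (toℕ j)

isOdd : ℕ → Bool
isOdd n = n % 2 ≡ᵇ 1

F : ∀ n → Graph n
F n = if isOdd n then join n 1 (replicate ((n ∸ 1) / 2) 2)
                 else join n 2 (replicate ((n ∸ 2) / 2) 2)

U : ∀ n → Graph n
U n = join n 3 (replicate ((n ∸ 3) / 2) 2 ++ replicate ((n + 1) % 2) 1)

T : ∀ n → Graph n
T n = if isOdd n then join n 1 (replicate 2 1 ++ replicate ((n ∸ 3) / 2) 2)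
                 else join n 1 (replicate 3 1 ++ replicate ((n ∸ 4) / 2) 2)

h : ℕ → ℕ
h n = if isOdd n then 2 ^ (n ∸ 1) + (n + 9) * 2 ^ ((n ∸ 7) / 2)
                 else 2 ^ (n ∸ 1) + (n + 12) * 2 ^ ((n ∸ 8) / 2)

{-# OPTIONS --safe #-}

-- Call a vertex c a centre if G - c has maximum degree at most one. Then G consists of c and legs:
-- pendant vertices, edges joined to c at one end, and edges joined to c at both ends. All subsets
-- avoiding c are dissociation sets, and 2 d(G) = 2^n + 2^b (2n - 3b), where b is the number of legs
-- of the second kind. This is strictly increasing in b; the largest b forces F_n and the second
-- largest forces U_n or T_n and gives the value h(n).
--
-- If G has no centre, it contains two disjoint paths P₃. To see this, grow a tree in G one vertex at
-- a time: after at most nine vertices it contains two disjoint paths P₃ itself, or it has a vertex c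
-- such that no three other vertices meet all paths P₃ through c, and then a path P₃ in G - c, which
-- exists since c is not a centre, misses one of those. Sliding one of the two disjoint paths along a
-- walk to the other makes them adjacent, so G contains a tree on six vertices spanned by two disjoint
-- paths P₃. Growing this tree further, a finite search shows that it has fewer than h(m) dissociation
-- sets at order m = 9 and 10, and at most 2^(m-1) at some order m ≤ 11. The latter persists when
-- vertices are added, so that d(G) < h(n).

module Submission where

open import Defs
open import Algebra.Properties.CommutativeSemigroup using (interchange)
open import Data.Bool using (Bool; true; false; _∧_; _∨_; not; if_then_else_)
import Data.Bool.Properties as Bool
open import Data.Empty using (⊥; ⊥-elim)
open import Data.Fin using (Fin; zero; suc; toℕ; punchIn; punchOut)
open import Data.Fin.Patterns using (0F; 1F; 2F; 3F)
open import Data.Fin.Permutation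
  using (Permutation; permutation; _⟨$⟩ʳ_; _⟨$⟩ˡ_; inverseˡ; inverseʳ; lift₀; _∘ₚ_; flip; ↔⇒≡) renaming (id to idₚ)
open import Data.Fin.Properties
  using (any?; injective⇒≤; punchOut-injective; punchIn-punchOut; suc-injective; ¬∀⟶∃¬) renaming (_≟_ to _≟F_)
open import Data.List using (List; []; _∷_; length; filter; map; _++_; allFin; replicate)
import Data.List as List
open import Data.List.Membership.Propositional using (_∈_)
open import Data.List.Membership.Propositional.Properties
  using (∈-filter⁺; ∈-filter⁻; ∈-allFin; ∈-map⁺; ∈-map⁻; ∈-++⁺ˡ; ∈-++⁺ʳ; ∈-lookup)
open import Data.List.Membership.Setoid.Properties using (index-injective)
open import Data.List.Properties using (filter-++; length-++; ++-identityʳ)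
import Data.List.Relation.Unary.All as All
open import Data.List.Relation.Unary.All using ([]; _∷_)
open import Data.List.Relation.Unary.AllPairs using ([]; _∷_)
open import Data.List.Relation.Unary.Any using (here; there; index)
open import Data.List.Relation.Unary.Unique.Propositional using (Unique)
import Data.List.Relation.Unary.Unique.Propositional.Properties as Unique
open import Data.Maybe using (Maybe; just; nothing; _<∣>_)
open import Data.Nat
  using (ℕ; zero; suc; _+_; _*_; _∸_; _^_; _/_; _%_; _≤_; _<_; z≤n; s≤s; _≤ᵇ_; _<ᵇ_; _≡ᵇ_; _≤?_; _<?_)
open import Data.Nat.Divisibility using (divides-refl)
open import Data.Nat.DivMod using ([m+kn]%n≡m%n; m*n/n≡m; m*n%n≡0; +-distrib-/-∣ʳ)
import Data.Nat.Properties as ℕ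
open import Data.Nat.Tactic.RingSolver using (solve-∀)
open import Data.Product using (Σ; ∃; ∃₂; _×_; _,_; proj₁; proj₂)
open import Data.Sum using (_⊎_; inj₁; inj₂; [_,_]′)
open import Data.Unit using (⊤; tt)
open import Data.Vec using (Vec; []; _∷_; lookup; tabulate; updateAt)
import Data.Vec as Vec
open import Data.Vec.Functional using () renaming (_∷_ to _◂_; [] to ◇)
import Data.Vec.Properties as Vec
open import Function using (_∘_)
open import Function.Bundles using (_⇔_; mk⇔; Equivalence)
open import Function.Definitions using (Injective)
open import Relation.Binary.PropositionalEquality
  using (_≡_; _≢_; refl; sym; trans; cong; cong₂; subst; setoid; module ≡-Reasoning)
open import Relation.Nullary using (¬_; Dec; yes; no; does)
open import Relation.Nullary.Decidable using (_×-dec_; _⊎-dec_; ¬?; decidable-stable)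
open import Relation.Unary using (Decidable)

-- Injections between finite sets and lists.

Inj : ∀ {A B : Set} → (A → B) → Set
Inj f = ∀ {x y} → f x ≡ f y → x ≡ y

true≢false : ∀ {b} → b ≡ true → b ≡ false → ⊥
true≢false refl ()

¬true⇒false : ∀ {b} → ¬ (b ≡ true) → b ≡ false
¬true⇒false {false} _ = refl
¬true⇒false {true}  h = ⊥-elim (h refl)

0≢suc : ∀ {n} {i : Fin n} → zero ≢ suc i
0≢suc ()

-- A missed value `y` could be punched out of the codomain, which would leave an injection into a
-- smaller finite set.
injective⇒surjective : ∀ {n} {f : Fin n → Fin n} → Inj f → ∀ y → ∃ λ x → f x ≡ y
injective⇒surjective {zero}  _   ()
injective⇒surjective {suc n} {f} inj y with any? (λ x → f x ≟F y)
... | yes hit = hit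
... | no miss = ⊥-elim (ℕ.1+n≰n (injective⇒≤ {f = g} g-inj))
  where
  ≢y : ∀ x → y ≢ f x
  ≢y x eq = miss (x , sym eq)
  g : Fin (suc n) → Fin n
  g x = punchOut (≢y x)
  g-inj : Injective _≡_ _≡_ g
  g-inj {a} {b} eq = inj (punchOut-injective (≢y a) (≢y b) eq)

lookup-unique : ∀ {A : Set} {xs : List A} → Unique xs → Inj (List.lookup xs)
lookup-unique (_ ∷ _)   {zero}  {zero}  _  = refl
lookup-unique (x∉ ∷ _)  {zero}  {suc j} eq = ⊥-elim (All.lookup x∉ (∈-lookup j) eq)
lookup-unique (x∉ ∷ _)  {suc i} {zero}  eq = ⊥-elim (All.lookup x∉ (∈-lookup i) (sym eq))
lookup-unique (_ ∷ xs!) {suc i} {suc j} eq = cong suc (lookup-unique xs! eq)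

-- Sending the position of an entry `x` to a position of `f x` in `ys` is injective, so the lengths
-- compare as the sizes of two `Fin`s.
length-≤ : ∀ {A B : Set} {xs : List A} {ys : List B} (f : A → B) → Unique xs → Inj f →
  (∀ {x} → x ∈ xs → f x ∈ ys) → length xs ≤ length ys
length-≤ {B = B} {xs} f xs! inj f∈ = injective⇒≤ {f = λ i → index (mem i)}
  λ {i} {j} eq → lookup-unique xs! (inj (index-injective (setoid B) (mem i) (mem j) eq))
  where
  mem = λ i → f∈ (∈-lookup {xs = xs} i)

-- Counting dissociation sets

allSubsets-complete : ∀ {n} (S : Subset n) → S ∈ allSubsets n
allSubsets-complete []          = here refl
allSubsets-complete (false ∷ S) = ∈-++⁺ˡ (∈-map⁺ _ (allSubsets-complete S))
allSubsets-complete (true ∷ S)  = ∈-++⁺ʳ _ (∈-map⁺ _ (allSubsets-complete S))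

allSubsets-unique : ∀ n → Unique (allSubsets n)
allSubsets-unique zero    = [] ∷ []
allSubsets-unique (suc n) = Unique.++⁺
  (Unique.map⁺ Vec.∷-injectiveʳ (allSubsets-unique n))
  (Unique.map⁺ Vec.∷-injectiveʳ (allSubsets-unique n))
  λ { (p , q) → disjoint (proj₂ (proj₂ (∈-map⁻ _ p))) (proj₂ (proj₂ (∈-map⁻ _ q))) }
  where
  disjoint : ∀ {S : Subset (suc n)} {A B} → S ≡ false ∷ A → S ≡ true ∷ B → ⊥
  disjoint refl ()

-- A form of `IsDissociation` free of counting, which passes easily through maps of vertices and the
-- deletion of a vertex.
Diss : ∀ {n} → Graph n → Subset n → Set
Diss G S = ∀ v x y → lookup S v ≡ true → lookup S x ≡ true → lookup S y ≡ true →
  G v x ≡ true → G v y ≡ true → x ≡ y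

length≤1⇒≡ : ∀ {A : Set} {xs : List A} {x y} → length xs ≤ 1 → x ∈ xs → y ∈ xs → x ≡ y
length≤1⇒≡ {xs = _ ∷ []} _ (here refl) (here refl) = refl
length≤1⇒≡ {xs = _ ∷ _ ∷ _} (s≤s ()) _ _

unique⇒length≤1 : ∀ {A : Set} {xs : List A} → Unique xs → (∀ {x y} → x ∈ xs → y ∈ xs → x ≡ y) → length xs ≤ 1
unique⇒length≤1 []        _ = z≤n
unique⇒length≤1 (_ ∷ [])  _ = s≤s z≤n
unique⇒length≤1 ((x≢y ∷ _) ∷ _ ∷ _) h = ⊥-elim (x≢y (h (here refl) (there (here refl))))

module _ {n} (G : Graph n) (S : Subset n) where
  private
    chosen? : Decidable (λ u → lookup S u ≡ true)
    chosen? u = lookup S u Bool.≟ true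
    adj? : ∀ v → Decidable (λ u → G v u ≡ true)
    adj? v u = G v u Bool.≟ true

  isDissociation⇒Diss : IsDissociation G S → Diss G S
  isDissociation⇒Diss h v x y v∈ x∈ y∈ vx vy = length≤1⇒≡ (h v v∈)
    (∈-filter⁺ chosen? (∈-filter⁺ (adj? v) (∈-allFin x) vx) x∈)
    (∈-filter⁺ chosen? (∈-filter⁺ (adj? v) (∈-allFin y) vy) y∈)

  Diss⇒isDissociation : Diss G S → IsDissociation G S
  Diss⇒isDissociation h v v∈ = unique⇒length≤1
    (Unique.filter⁺ chosen? (Unique.filter⁺ (adj? v) (Unique.allFin⁺ n)))
    λ {x} {y} x∈ y∈ →
      let xN , xS = ∈-filter⁻ chosen? x∈
          yN , yS = ∈-filter⁻ chosen? y∈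
      in h v x y v∈ xS yS (proj₂ (∈-filter⁻ (adj? v) {xs = allFin n} xN))
          (proj₂ (∈-filter⁻ (adj? v) {xs = allFin n} yN))

-- Since `e` is also onto, pulling sets back along it is injective, and chosen vertices adjacent in
-- `H` come from chosen vertices adjacent in `G`. Serves both for spanning trees and for
-- isomorphisms.
d-antitone : ∀ {n} {G H : Graph n} (e : Fin n → Fin n) → Inj e →
  (∀ i j → H i j ≡ true → G (e i) (e j) ≡ true) → d G ≤ d H
d-antitone {n} {G} {H} e inj edge = length-≤ pull (Unique.filter⁺ (isDissociation? G) (allSubsets-unique n))
  pull-inj λ {S} S∈ → ∈-filter⁺ (isDissociation? H) (allSubsets-complete (pull S))
    (Diss⇒isDissociation H (pull S)
        (pull-diss S (isDissociation⇒Diss G S (proj₂ (∈-filter⁻ (isDissociation? G) {xs = allSubsets n} S∈)))))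
  where
  pull : Subset n → Subset n
  pull S = tabulate (lookup S ∘ e)
  pull-inj : Inj pull
  pull-inj {S} {S'} eq = trans (sym (Vec.tabulate∘lookup S)) (trans (Vec.tabulate-cong same) (Vec.tabulate∘lookup S'))
    where
    same : ∀ y → lookup S y ≡ lookup S' y
    same y with x , refl ← injective⇒surjective inj y =
      trans (sym (Vec.lookup∘tabulate (lookup S ∘ e) x))
          (trans (cong (λ V → lookup V x) eq) (Vec.lookup∘tabulate (lookup S' ∘ e) x))
  back : ∀ S v → lookup (pull S) v ≡ true → lookup S (e v) ≡ true
  back S v = trans (sym (Vec.lookup∘tabulate (lookup S ∘ e) v))
  pull-diss : ∀ S → Diss G S → Diss H (pull S)
  pull-diss S h v x y v∈ x∈ y∈ vx vy =
      inj (h _ _ _ (back S v v∈) (back S x x∈) (back S y y∈) (edge v x vx) (edge v y vy))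

-- Recursion on the first vertex matches trees and legs, whose newest vertices come first, so that
-- sums can be evaluated along their structure.
sumS : ∀ n → (Subset n → ℕ) → ℕ
sumS zero    f = f []
sumS (suc n) f = sumS n (f ∘ (false ∷_)) + sumS n (f ∘ (true ∷_))

sumS-cong : ∀ n {f g : Subset n → ℕ} → (∀ S → f S ≡ g S) → sumS n f ≡ sumS n g
sumS-cong zero    h = h []
sumS-cong (suc n) h = cong₂ _+_ (sumS-cong n (h ∘ (false ∷_))) (sumS-cong n (h ∘ (true ∷_)))

sumS-mono : ∀ n {f g : Subset n → ℕ} → (∀ S → f S ≤ g S) → sumS n f ≤ sumS n g
sumS-mono zero    h = h []
sumS-mono (suc n) h = ℕ.+-mono-≤ (sumS-mono n (h ∘ (false ∷_))) (sumS-mono n (h ∘ (true ∷_)))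

sumS-+ : ∀ n (f g : Subset n → ℕ) → sumS n (λ S → f S + g S) ≡ sumS n f + sumS n g
sumS-+ zero    f g = refl
sumS-+ (suc n) f g = trans
  (cong₂ _+_ (sumS-+ n (f ∘ (false ∷_)) (g ∘ (false ∷_))) (sumS-+ n (f ∘ (true ∷_)) (g ∘ (true ∷_))))
  (interchange ℕ.+-commutativeSemigroup (sumS n (f ∘ (false ∷_))) _ _ _)

sumS-1 : ∀ n → sumS n (λ _ → 1) ≡ 2 ^ n
sumS-1 zero    = refl
sumS-1 (suc n) = cong₂ _+_ (sumS-1 n) (trans (sumS-1 n) (sym (ℕ.+-identityʳ (2 ^ n))))

sumS-0 : ∀ n → sumS n (λ _ → 0) ≡ 0
sumS-0 zero    = refl
sumS-0 (suc n) = cong₂ _+_ (sumS-0 n) (sumS-0 n)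

[_] : Bool → ℕ
[ true ]  = 1
[ false ] = 0

length-filter-map : ∀ {A B : Set} {P : B → Set} (P? : Decidable P) (f : A → B) xs →
  length (filter P? (map f xs)) ≡ length (filter (P? ∘ f) xs)
length-filter-map P? f []       = refl
length-filter-map P? f (x ∷ xs) with does (P? (f x))
... | true  = cong suc (length-filter-map P? f xs)
... | false = length-filter-map P? f xs

length-filter≡sumS : ∀ n {P : Subset n → Set} (P? : Decidable P) →
  length (filter P? (allSubsets n)) ≡ sumS n (λ S → [ does (P? S) ])
length-filter≡sumS zero    P? with does (P? [])
... | true  = refl
... | false = refl
length-filter≡sumS (suc n) P? = begin
  length (filter P? (map (false ∷_) A ++ map (true ∷_) A))
    ≡⟨ cong length (filter-++ P? (map (false ∷_) A) _) ⟩
  length (filter P? (map (false ∷_) A) ++ filter P? (map (true ∷_) A))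
    ≡⟨ length-++ (filter P? (map (false ∷_) A)) ⟩
  length (filter P? (map (false ∷_) A)) + length (filter P? (map (true ∷_) A))
    ≡⟨ cong₂ _+_ (trans (length-filter-map P? _ A) (length-filter≡sumS n _))
        (trans (length-filter-map P? _ A) (length-filter≡sumS n _)) ⟩
  _ ∎
  where
  open ≡-Reasoning
  A = allSubsets n

does-≤ : ∀ {P : Set} (p? : Dec P) {k} → (P → 1 ≤ k) → [ does p? ] ≤ k
does-≤ (yes p) h = h p
does-≤ (no _)  _ = z≤n

does-≡ : ∀ {P : Set} (p? : Dec P) {b} → (P → b ≡ true) → (b ≡ true → P) → does p? ≡ b
does-≡ (yes p) h k = sym (h p)
does-≡ (no ¬p) h k = sym (¬true⇒false (¬p ∘ k))

d≤sumS : ∀ {n} (G : Graph n) (f : Subset n → ℕ) → (∀ S → Diss G S → 1 ≤ f S) → d G ≤ sumS n f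
d≤sumS {n} G f h = ℕ.≤-trans (ℕ.≤-reflexive (length-filter≡sumS n (isDissociation? G)))
  (sumS-mono n λ S → does-≤ (isDissociation? G S) (h S ∘ isDissociation⇒Diss G S))

d≡sumS : ∀ {n} (G : Graph n) (f : Subset n → Bool) → (∀ S → Diss G S → f S ≡ true) → (∀ S → f S ≡ true → Diss G S) →
  d G ≡ sumS n ([_] ∘ f)
d≡sumS {n} G f h k = trans (length-filter≡sumS n (isDissociation? G))
  (sumS-cong n λ S → cong [_]
      (does-≡ (isDissociation? G S) (h S ∘ isDissociation⇒Diss G S) (Diss⇒isDissociation G S ∘ k S)))

delete₀ : ∀ {n} → Graph (suc n) → Graph n
delete₀ G i j = G (suc i) (suc j)

Diss-delete₀ : ∀ {n} {G : Graph (suc n)} {b S} → Diss G (b ∷ S) → Diss (delete₀ G) S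
Diss-delete₀ h v x y v∈ x∈ y∈ vx vy = suc-injective (h (suc v) (suc x) (suc y) v∈ x∈ y∈ vx vy)

-- Dropping vertex `zero` leaves a dissociation set of the rest, and each of those arises from at
-- most two sets.
d-delete₀ : ∀ {n} (G : Graph (suc n)) → d G ≤ d (delete₀ G) + d (delete₀ G)
d-delete₀ {n} G = ℕ.≤-trans (d≤sumS G f one) (ℕ.+-mono-≤ H≤ H≤)
  where
  H = delete₀ G
  f : Subset (suc n) → ℕ
  f (_ ∷ S) = [ does (isDissociation? H S) ]
  H≤ : sumS n (λ S → [ does (isDissociation? H S) ]) ≤ d H
  H≤ = ℕ.≤-reflexive (sym (length-filter≡sumS n (isDissociation? H)))
  one : ∀ S → Diss G S → 1 ≤ f S
  one (b ∷ S) h = ℕ.≤-reflexive (cong [_] (sym (does-≡ (isDissociation? H S) {true} (λ _ → refl)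
    (λ _ → Diss⇒isDissociation H S (Diss-delete₀ {G = G} {b} {S} h)))))

eqᵇ : ∀ {n} → Fin n → Fin n → Bool
eqᵇ zero    zero    = true
eqᵇ zero    (suc _) = false
eqᵇ (suc _) zero    = false
eqᵇ (suc i) (suc j) = eqᵇ i j

eqᵇ⇒≡ : ∀ {n} {i j : Fin n} → eqᵇ i j ≡ true → i ≡ j
eqᵇ⇒≡ {i = zero}  {zero}  _ = refl
eqᵇ⇒≡ {i = suc _} {suc _} e = cong suc (eqᵇ⇒≡ e)

eqᵇ-refl : ∀ {n} (i : Fin n) → eqᵇ i i ≡ true
eqᵇ-refl zero    = refl
eqᵇ-refl (suc i) = eqᵇ-refl i

-- Weighted counting on trees

-- The newest leaf is vertex `zero` and older vertices move up by one, so deleting vertices in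
-- numerical order always deletes a leaf.
data Tree : ℕ → Set where
  root : Tree 1
  leaf : ∀ {m} → Fin m → Tree m → Tree (suc m)

treeG : ∀ {m} → Tree m → Graph m
treeG root       _       _       = false
treeG (leaf p T) zero    zero    = false
treeG (leaf p T) zero    (suc j) = eqᵇ p j
treeG (leaf p T) (suc i) zero    = eqᵇ p i
treeG (leaf p T) (suc i) (suc j) = treeG T i j

-- wt a x y weighs a vertex by a if it is not chosen, and if it is chosen by x or y
-- according to whether none or exactly one of its neighbours is chosen.
data Weight : Set where
  wt : ℕ → ℕ → ℕ → Weight

_⊕_ : Weight → Weight → Weight
wt a x y ⊕ wt a' x' y' = wt (a + a') (x + x') (y + y')

-- absorb b l w: the new weight of a vertex of weight w when a leaf of weight l at it is removed,
-- the leaf being chosen if b holds.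
absorb : Bool → Weight → Weight → Weight
absorb false (wt a _ _) (wt A X Y) = wt (a * A) (a * X) (a * Y)
absorb true  (wt _ x y) (wt A X Y) = wt (x * A) (y * Y) 0

merge : Weight → Weight → Weight
merge l w = absorb false l w ⊕ absorb true l w

-- Leaves are removed one by one, each handing its contribution to its neighbour. From weights
-- `wt 1 1 1` the outcome is positive on every dissociation set.
eval : ∀ {m} → Tree m → Vec Weight m → Subset m → ℕ
eval root       (wt a _ _ ∷ []) (false ∷ []) = a
eval root       (wt _ x _ ∷ []) (true ∷ [])  = x
eval (leaf p T) (l ∷ w)         (b ∷ S)      = eval T (updateAt w p (absorb b l)) S

total : ∀ {m} → Tree m → Vec Weight m → ℕ
total root       (wt a x _ ∷ []) = a + x
total (leaf p T) (l ∷ w)         = total T (updateAt w p (merge l))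

absorb-⊕ˡ : ∀ b l l' w → absorb b (l ⊕ l') w ≡ absorb b l w ⊕ absorb b l' w
absorb-⊕ˡ false (wt a _ _) (wt a' _ _) (wt A X Y)
  rewrite ℕ.*-distribʳ-+ A a a' | ℕ.*-distribʳ-+ X a a' | ℕ.*-distribʳ-+ Y a a' = refl
absorb-⊕ˡ true (wt _ x y) (wt _ x' y') (wt A X Y)
  rewrite ℕ.*-distribʳ-+ A x x' | ℕ.*-distribʳ-+ Y y y' = refl

absorb-⊕ʳ : ∀ b l w w' → absorb b l (w ⊕ w') ≡ absorb b l w ⊕ absorb b l w'
absorb-⊕ʳ false (wt a _ _) (wt A X Y) (wt A' X' Y')
  rewrite ℕ.*-distribˡ-+ a A A' | ℕ.*-distribˡ-+ a X X' | ℕ.*-distribˡ-+ a Y Y' = refl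
absorb-⊕ʳ true (wt _ x y) (wt A X Y) (wt A' X' Y')
  rewrite ℕ.*-distribˡ-+ x A A' | ℕ.*-distribˡ-+ y Y Y' = refl

-- Additivity in a single weight. It lets the two choices for a leaf be merged before the recursion
-- descends, so `total` sums over all subsets in one pass over the tree. The cases ask whether `p`
-- is the neighbour of the leaf removed next.
eval-⊕ : ∀ {m} (T : Tree m) w p (f g : Weight → Weight) S →
  eval T (updateAt w p (λ z → f z ⊕ g z)) S ≡ eval T (updateAt w p f) S + eval T (updateAt w p g) S
eval-⊕ root (z ∷ []) zero f g (b ∷ []) with f z | g z | b
... | wt _ _ _ | wt _ _ _ | false = refl
... | wt _ _ _ | wt _ _ _ | true  = refl
eval-⊕ (leaf q T) (l ∷ w) zero f g (b ∷ S) = trans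
  (cong (λ v → eval T v S) (Vec.updateAt-cong q (absorb-⊕ˡ b (f l) (g l)) w))
  (eval-⊕ T w q (absorb b (f l)) (absorb b (g l)) S)
eval-⊕ (leaf q T) (l ∷ w) (suc p) f g (b ∷ S) with p ≟F q
... | yes refl = begin
  eval T (updateAt (updateAt w p (λ z → f z ⊕ g z)) p (absorb b l)) S
    ≡⟨ cong (λ v → eval T v S)
        (trans (Vec.updateAt-updateAt p w) (Vec.updateAt-cong p (λ z → absorb-⊕ʳ b l (f z) (g z)) w)) ⟩
  eval T (updateAt w p (λ z → absorb b l (f z) ⊕ absorb b l (g z))) S
    ≡⟨ eval-⊕ T w p (absorb b l ∘ f) (absorb b l ∘ g) S ⟩
  eval T (updateAt w p (absorb b l ∘ f)) S + eval T (updateAt w p (absorb b l ∘ g)) S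
    ≡⟨ cong₂ (λ v v' → eval T v S + eval T v' S) (Vec.updateAt-updateAt p w) (Vec.updateAt-updateAt p w) ⟨
  _ ∎
  where open ≡-Reasoning
... | no p≢q = begin
  eval T (updateAt (updateAt w p (λ z → f z ⊕ g z)) q (absorb b l)) S
    ≡⟨ cong (λ v → eval T v S) (Vec.updateAt-commutes q p (p≢q ∘ sym) w) ⟩
  eval T (updateAt (updateAt w q (absorb b l)) p (λ z → f z ⊕ g z)) S
    ≡⟨ eval-⊕ T (updateAt w q (absorb b l)) p f g S ⟩
  eval T (updateAt (updateAt w q (absorb b l)) p f) S + eval T (updateAt (updateAt w q (absorb b l)) p g) S
    ≡⟨ cong₂ (λ v v' → eval T v S + eval T v' S) (Vec.updateAt-commutes p q p≢q w) (Vec.updateAt-commutes p q p≢q w) ⟩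
  _ ∎
  where open ≡-Reasoning

sumS-eval : ∀ {m} (T : Tree m) w → sumS m (eval T w) ≡ total T w
sumS-eval root (wt _ _ _ ∷ []) = refl
sumS-eval (leaf {m} p T) (l ∷ w) = begin
  sumS m (eval T (updateAt w p (absorb false l))) + sumS m (eval T (updateAt w p (absorb true l)))
    ≡⟨ sumS-+ m _ _ ⟨
  sumS m (λ S → eval T (updateAt w p (absorb false l)) S + eval T (updateAt w p (absorb true l)) S)
    ≡⟨ sumS-cong m (eval-⊕ T w p (absorb false l) (absorb true l)) ⟨
  sumS m (eval T (updateAt w p (merge l)))
    ≡⟨ sumS-eval T _ ⟩
  total T (updateAt w p (merge l)) ∎
  where open ≡-Reasoning

-- At a chosen vertex with y = 0 the only dissociation sets of positive weight are those
-- containing none of its neighbours.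
Admits : ∀ {m} → Tree m → Subset m → Fin m → Weight → Set
Admits T S i (wt a x y) = (lookup S i ≡ false → 1 ≤ a)
  × (lookup S i ≡ true → 1 ≤ x × (1 ≤ y ⊎ (∀ j → lookup S j ≡ true → treeG T i j ≡ true → ⊥)))

-- Induction on leaf removal: after the leaf is absorbed, the new weight of its neighbour still
-- admits the rest of the set.
eval-positive : ∀ {m} (T : Tree m) w S → Diss (treeG T) S → (∀ i → Admits T S i (lookup w i)) → 1 ≤ eval T w S
eval-positive root (wt _ _ _ ∷ []) (false ∷ []) h adm = proj₁ (adm zero) refl
eval-positive root (wt _ _ _ ∷ []) (true ∷ [])  h adm = proj₁ (proj₂ (adm zero) refl)
eval-positive (leaf p T) (l ∷ w) (b ∷ S) h adm =
  eval-positive T _ S (λ v x y → Diss-delete₀ {G = treeG (leaf p T)} {b} {S} h v x y) admits'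
  where
  keep : ∀ {i z} → Admits (leaf p T) (b ∷ S) (suc i) z → Admits T S i z
  keep {z = wt _ _ _} (out , inn) = out , λ i∈ → proj₁ (inn i∈) , weaken (proj₂ (inn i∈))
    where
    weaken : ∀ {y i} → (1 ≤ y ⊎ (∀ j → lookup (b ∷ S) j ≡ true → treeG (leaf p T) (suc i) j ≡ true → ⊥)) →
      1 ≤ y ⊎ (∀ j → lookup S j ≡ true → treeG T i j ≡ true → ⊥)
    weaken (inj₁ y≥1)  = inj₁ y≥1
    weaken (inj₂ none) = inj₂ (none ∘ suc)
  pick-y : ∀ {U i y j} → (1 ≤ y ⊎ (∀ j → lookup (b ∷ S) j ≡ true → treeG U i j ≡ true → ⊥)) →
    lookup (b ∷ S) j ≡ true → treeG U i j ≡ true → 1 ≤ y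
  pick-y (inj₁ y≥1)  _  _ = y≥1
  pick-y (inj₂ none) j∈ e = ⊥-elim (none _ j∈ e)
  at-p : ∀ l z → Admits (leaf p T) (b ∷ S) zero l → Admits (leaf p T) (b ∷ S) (suc p) z → ∀ b' → b ≡ b' →
      Admits T S p (absorb b' l z)
  at-p (wt a x y) (wt A X Y) adm₀ admₚ false b≡ = (λ p∉ → ℕ.*-mono-≤ a≥1 (proj₁ admₚ p∉)) ,
    λ p∈ → ℕ.*-mono-≤ a≥1 (proj₁ (proj₂ admₚ p∈)) , scale (proj₂ (proj₂ admₚ p∈))
    where
    a≥1 = proj₁ adm₀ b≡
    scale : ∀ {Y} → (1 ≤ Y ⊎ (∀ j → lookup (b ∷ S) j ≡ true → treeG (leaf p T) (suc p) j ≡ true → ⊥)) →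
      1 ≤ a * Y ⊎ (∀ j → lookup S j ≡ true → treeG T p j ≡ true → ⊥)
    scale (inj₁ y≥1)  = inj₁ (ℕ.*-mono-≤ a≥1 y≥1)
    scale (inj₂ none) = inj₂ (none ∘ suc)
  at-p (wt a x y) (wt A X Y) adm₀ admₚ true b≡ = (λ p∉ → ℕ.*-mono-≤ (proj₁ (proj₂ adm₀ b≡)) (proj₁ admₚ p∉)) ,
    λ p∈ → ℕ.*-mono-≤ (pick-y {leaf p T} {zero} {j = suc p} (proj₂ (proj₂ adm₀ b≡)) p∈ (eqᵇ-refl p))
                      (pick-y {leaf p T} {suc p} {j = zero} (proj₂ (proj₂ admₚ p∈)) b≡ (eqᵇ-refl p)) ,
           -- The new third weight is 0, so `p` must have no chosen neighbour left: one would be its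
           -- second, besides the leaf.
           inj₂ λ j j∈ e → 0≢suc (h (suc p) zero (suc j) p∈ b≡ j∈ (eqᵇ-refl p) e)
  admits' : ∀ i → Admits T S i (lookup (updateAt w p (absorb b l)) i)
  admits' i with i ≟F p
  ... | yes refl = subst (Admits T S i) (sym (Vec.lookup∘updateAt i w))
      (at-p l (lookup w i) (adm zero) (adm (suc i)) b refl)
  ... | no i≢p = subst (Admits T S i) (sym (Vec.lookup∘updateAt′ i p i≢p w)) (keep {i} {lookup w i} (adm (suc i)))

d-tree≤total : ∀ {m} (T : Tree m) → d (treeG T) ≤ total T (Vec.replicate m (wt 1 1 1))
d-tree≤total {m} T = ℕ.≤-trans (d≤sumS (treeG T) (eval T _) λ S h → eval-positive T _ S h admits)
  (ℕ.≤-reflexive (sumS-eval T _))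
  where
  admits : ∀ {S} i → Admits T S i (lookup (Vec.replicate m (wt 1 1 1)) i)
  admits {S} i = subst (Admits T S i) (sym (Vec.lookup-replicate i (wt 1 1 1)))
    ((λ _ → s≤s z≤n) , λ _ → s≤s z≤n , inj₁ (s≤s z≤n))

-- Growing trees in a connected graph

∧-true : ∀ {a b} → a ∧ b ≡ true → a ≡ true × b ≡ true
∧-true {true} {true} _ = refl , refl

∨-true : ∀ {a b} → a ∨ b ≡ true → a ≡ true ⊎ b ≡ true
∨-true {true}  _ = inj₁ refl
∨-true {false} e = inj₂ e

not-true : ∀ {a} → not a ≡ true → a ≡ true → ⊥
not-true {false} _ ()

∉image⇒n≤m : ∀ {m n} (e : Fin m → Fin n) → (∀ v → ∃ λ i → e i ≡ v) → n ≤ m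
∉image⇒n≤m e pre = injective⇒≤ {f = proj₁ ∘ pre} λ {x} {y} eq →
  trans (sym (proj₂ (pre x))) (trans (cong e eq) (proj₂ (pre y)))

missed : ∀ {m n} (e : Fin m → Fin n) → m < n → ∃ λ v → ∀ i → e i ≢ v
missed {m} {n} e m<n with ¬∀⟶∃¬ n _ (λ v → any? (λ i → e i ≟F v)) (ℕ.<⇒≱ m<n ∘ ∉image⇒n≤m e)
... | v , miss = v , λ i eq → miss (i , eq)

crossing : ∀ {n} {G : Graph n} {P : Fin n → Set} → Decidable P → ∀ {u v} → Reach G u v → P u → ¬ P v →
  ∃₂ λ x y → P x × ¬ P y × G x y ≡ true
crossing P? here Pu ¬Pv = ⊥-elim (¬Pv Pu)
crossing P? (step {w} {v} r wv) Pu ¬Pv with P? w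
... | yes Pw = w , v , Pw , ¬Pv , wv
... | no ¬Pw = crossing P? r Pu ¬Pw

exit : ∀ {m n} {G : Graph n} → Connected G → (e : Fin m → Fin n) → Fin m → m < n →
  ∃₂ λ i x → G (e i) x ≡ true × (∀ j → e j ≢ x)
exit conn e i₀ m<n with v , v∉ ← missed e m<n
  with _ , x , (i , refl) , x∉ , ix ← crossing (λ v → any? (λ i → e i ≟F v)) (conn (e i₀) v) (i₀ , refl)
      (λ { (i , eq) → v∉ i eq })
  = i , x , ix , λ j eq → x∉ (j , eq)

record Embeds {m n} (T : Tree m) (G : Graph n) (e : Fin m → Fin n) : Set where
  constructor embedding
  field
    injective : Inj e
    edges     : ∀ i j → treeG T i j ≡ true → G (e i) (e j) ≡ true

◂-inj : ∀ {m} {A : Set} {e : Fin m → A} {x} → Inj e → (∀ i → e i ≢ x) → Inj (x ◂ e)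
◂-inj inj x∉ {zero}  {zero}  _  = refl
◂-inj inj x∉ {zero}  {suc j} eq = ⊥-elim (x∉ j (sym eq))
◂-inj inj x∉ {suc i} {zero}  eq = ⊥-elim (x∉ i eq)
◂-inj inj x∉ {suc i} {suc j} eq = cong suc (inj eq)

embeds-leaf : ∀ {m n} {G : Graph n} {T : Tree m} {e} → IsSimple G → Embeds T G e → ∀ p {x} → (∀ i → e i ≢ x) →
  G (e p) x ≡ true → Embeds (leaf p T) G (x ◂ e)
embeds-leaf {G = G} {T} {e} (symm , _) (embedding inj edge) p {x} x∉ px = embedding (◂-inj inj x∉) edge'
  where
  edge' : ∀ i j → treeG (leaf p T) i j ≡ true → G ((x ◂ e) i) ((x ◂ e) j) ≡ true
  edge' zero    (suc j) eq with refl ← eqᵇ⇒≡ {i = p} eq = trans (symm _ _) px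
  edge' (suc i) zero    eq with refl ← eqᵇ⇒≡ {i = p} eq = px
  edge' (suc i) (suc j) eq = edge i j eq

some : ∀ {m} → Tree m → Fin m
some root       = zero
some (leaf _ _) = zero

grow : ∀ {m n} {G : Graph n} {T : Tree m} {e} → IsSimple G → Connected G → Embeds T G e → m < n →
  ∃₂ λ p x → Embeds (leaf p T) G (x ◂ e)
grow {T = T} {e} simple conn emb m<n with p , x , px , x∉ ← exit conn e (some T) m<n
  = p , x , embeds-leaf simple emb p x∉ px

-- Searching trees for two disjoint paths or a robust vertex.

anyᵇ allᵇ : ∀ {n} → (Fin n → Bool) → Bool
anyᵇ {zero}  f = false
anyᵇ {suc n} f = f zero ∨ anyᵇ (f ∘ suc)
allᵇ {zero}  f = true
allᵇ {suc n} f = f zero ∧ allᵇ (f ∘ suc)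

anyᵇ-sound : ∀ {n} (f : Fin n → Bool) → anyᵇ f ≡ true → ∃ λ i → f i ≡ true
anyᵇ-sound {suc n} f eq with ∨-true {f zero} eq
... | inj₁ f0 = zero , f0
... | inj₂ fs with i , fi ← anyᵇ-sound (f ∘ suc) fs = suc i , fi

allᵇ-sound : ∀ {n} (f : Fin n → Bool) → allᵇ f ≡ true → ∀ i → f i ≡ true
allᵇ-sound f eq zero    = proj₁ (∧-true eq)
allᵇ-sound f eq (suc i) = allᵇ-sound (f ∘ suc) (proj₂ (∧-true {f zero} eq)) i

Triple : ℕ → Set
Triple n = Fin n × Fin n × Fin n

_∈₃_ : ∀ {n} → Fin n → Triple n → Set
x ∈₃ (a , b , c) = x ≡ a ⊎ x ≡ b ⊎ x ≡ c

_∈₃?_ : ∀ {n} (x : Fin n) A → Dec (x ∈₃ A)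
x ∈₃? (a , b , c) = x ≟F a ⊎-dec x ≟F b ⊎-dec x ≟F c

_∈₃ᵇ_ : ∀ {n} → Fin n → Triple n → Bool
x ∈₃ᵇ (a , b , c) = eqᵇ x a ∨ eqᵇ x b ∨ eqᵇ x c

∈₃ᵇ-complete : ∀ {n} {x : Fin n} A → x ∈₃ A → x ∈₃ᵇ A ≡ true
∈₃ᵇ-complete {x = x} A (inj₁ refl)        rewrite eqᵇ-refl x = refl
∈₃ᵇ-complete {x = x} (a , _) (inj₂ (inj₁ refl)) rewrite eqᵇ-refl x = Bool.∨-zeroʳ (eqᵇ x a)
∈₃ᵇ-complete {x = x} (a , b , _) (inj₂ (inj₂ refl)) rewrite eqᵇ-refl x | Bool.∨-zeroʳ (eqᵇ x b) = Bool.∨-zeroʳ (eqᵇ x a)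

-- A path a - b - c, not necessarily induced.
P₃ : ∀ {n} → Graph n → Triple n → Set
P₃ G (a , b , c) = G a b ≡ true × G b c ≡ true × a ≢ c

Disjoint : ∀ {n} → Triple n → Triple n → Set
Disjoint A B = ∀ x → x ∈₃ A → x ∈₃ B → ⊥

DisjointP₃s : ∀ {n} → Graph n → Set
DisjointP₃s G = ∃₂ λ A B → P₃ G A × P₃ G B × Disjoint A B

-- Applied with `A` a path P₃ of G - c, so that `A` and `B` are the two disjoint paths sought.
Robust : ∀ {n} → Graph n → Fin n → Set
Robust G c = ∀ A → ¬ (c ∈₃ A) → ∃ λ B → P₃ G B × Disjoint A B

-- For a neighbour `p` of `c`, either p - c - q or c - p - q is a path.
linksᵇ : ∀ {n} → Graph n → Fin n → Fin n → Fin n → Bool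
linksᵇ G c p q = (G c q ∧ not (eqᵇ p q)) ∨ (G p q ∧ not (eqᵇ c q))

firstJust : ∀ {n} {A : Set} → (Fin n → Maybe A) → Maybe A
firstJust {zero}  f = nothing
firstJust {suc n} f = f zero <∣> firstJust (f ∘ suc)

pathThrough : ∀ {n} → Graph n → Fin n → (Fin n → Bool) → Maybe (Fin n × Fin n)
pathThrough G c S = firstJust λ p → if G c p ∧ not (S p)
  then firstJust (λ q → if not (S q) ∧ linksᵇ G c p q then just (p , q) else nothing)
  else nothing

-- Branching for a hitting set: k further vertices can only destroy all paths through c
-- if one of them lies on the path that was found.
survivesᵇ : ∀ {n} → Graph n → Fin n → ℕ → (Fin n → Bool) → Bool
survivesᵇ G c k S with pathThrough G c S
... | nothing = false
survivesᵇ G c zero S    | just _       = true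
survivesᵇ G c (suc k) S | just (p , q) =
  survivesᵇ G c k (λ v → eqᵇ v p ∨ S v) ∧ survivesᵇ G c k (λ v → eqᵇ v q ∨ S v)

robustᵇ : ∀ {n} → Graph n → Fin n → Bool
robustᵇ G c = survivesᵇ G c 3 (λ _ → false)

-- One of the paths is required to start at `a`. In `splits` this is the newest leaf: a pair of
-- paths absent from the tree before must use that leaf, and as the end of a path, its degree being
-- one.
disjointP₃sᵇ : ∀ {n} → Graph n → Fin n → Bool
disjointP₃sᵇ G a = anyᵇ λ b → G a b ∧ anyᵇ λ c → (G b c ∧ not (eqᵇ a c)) ∧
  anyᵇ λ y → not (y ∈₃ᵇ (a , b , c)) ∧ anyᵇ λ x → (G x y ∧ not (x ∈₃ᵇ (a , b , c))) ∧
  anyᵇ λ z → (G y z ∧ not (eqᵇ x z)) ∧ not (z ∈₃ᵇ (a , b , c))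

¬eqᵇ⇒≢ : ∀ {n} {i j : Fin n} → not (eqᵇ i j) ≡ true → i ≢ j
¬eqᵇ⇒≢ {i = i} h refl = not-true h (eqᵇ-refl i)

¬∈₃ᵇ⇒∉ : ∀ {n} {x : Fin n} A → not (x ∈₃ᵇ A) ≡ true → ¬ (x ∈₃ A)
¬∈₃ᵇ⇒∉ A h x∈ = not-true h (∈₃ᵇ-complete A x∈)

∉⇒Disjoint : ∀ {n} {A : Triple n} {x y z} → ¬ (x ∈₃ A) → ¬ (y ∈₃ A) → ¬ (z ∈₃ A) → Disjoint A (x , y , z)
∉⇒Disjoint x∉ y∉ z∉ _ v∈ (inj₁ refl)        = x∉ v∈
∉⇒Disjoint x∉ y∉ z∉ _ v∈ (inj₂ (inj₁ refl)) = y∉ v∈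
∉⇒Disjoint x∉ y∉ z∉ _ v∈ (inj₂ (inj₂ refl)) = z∉ v∈

disjointP₃sᵇ-sound : ∀ {n} (G : Graph n) a → disjointP₃sᵇ G a ≡ true → DisjointP₃s G
disjointP₃sᵇ-sound G a eq
  with b , eq ← anyᵇ-sound _ eq
  with ab , eq ← ∧-true {G a b} eq
  with c , eq ← anyᵇ-sound _ eq
  with bc , eq ← ∧-true {G b c ∧ not (eqᵇ a c)} eq
  with bc , a≢c ← ∧-true {G b c} bc
  with y , eq ← anyᵇ-sound _ eq
  with y∉ , eq ← ∧-true {not (y ∈₃ᵇ (a , b , c))} eq
  with x , eq ← anyᵇ-sound _ eq
  with xy , eq ← ∧-true {G x y ∧ not (x ∈₃ᵇ (a , b , c))} eq
  with xy , x∉ ← ∧-true {G x y} xy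
  with z , eq ← anyᵇ-sound _ eq
  with yz , z∉ ← ∧-true {G y z ∧ not (eqᵇ x z)} eq
  with yz , x≢z ← ∧-true {G y z} yz
  = (a , b , c) , (x , y , z) , (ab , bc , ¬eqᵇ⇒≢ a≢c) , (xy , yz , ¬eqᵇ⇒≢ x≢z) ,
    ∉⇒Disjoint (¬∈₃ᵇ⇒∉ _ x∉) (¬∈₃ᵇ⇒∉ _ y∉) (¬∈₃ᵇ⇒∉ _ z∉)

∈₃-map⁻ : ∀ {m n} {e : Fin m → Fin n} {a b c x} → x ∈₃ (e a , e b , e c) → ∃ λ i → i ∈₃ (a , b , c) × x ≡ e i
∈₃-map⁻ {a = a} (inj₁ refl)             = a , inj₁ refl , refl
∈₃-map⁻ {b = b} (inj₂ (inj₁ refl))      = b , inj₂ (inj₁ refl) , refl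
∈₃-map⁻ {c = c} (inj₂ (inj₂ refl))      = c , inj₂ (inj₂ refl) , refl

embeds-disjointP₃s : ∀ {m n} {G : Graph n} {T : Tree m} {e} → Embeds T G e → DisjointP₃s (treeG T) → DisjointP₃s G
embeds-disjointP₃s {e = e} (embedding inj edge) ((a , b , c) , (x , y , z) , (ab , bc , a≢c) , (xy , yz , x≢z) , disj) =
  (e a , e b , e c) , (e x , e y , e z) , (edge _ _ ab , edge _ _ bc , a≢c ∘ inj) ,
      (edge _ _ xy , edge _ _ yz , x≢z ∘ inj) ,
  disj'
  where
  disj' : Disjoint (e a , e b , e c) (e x , e y , e z)
  disj' v v∈A v∈B
    with i , i∈A , v≡ei ← ∈₃-map⁻ {e = e} v∈A
    with j , j∈B , v≡ej ← ∈₃-map⁻ {e = e} v∈B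
    with refl ← inj (trans (sym v≡ei) v≡ej) = disj i i∈A j∈B

firstJust-sound : ∀ {n} {A : Set} (f : Fin n → Maybe A) {a} → firstJust f ≡ just a → ∃ λ i → f i ≡ just a
firstJust-sound {suc n} f eq with f zero in f0
... | just _  = zero , trans f0 eq
... | nothing with i , fi ← firstJust-sound (f ∘ suc) eq = suc i , fi

guard-just : ∀ {A : Set} b {m : Maybe A} {a} → (if b then m else nothing) ≡ just a → b ≡ true × m ≡ just a
guard-just true eq = refl , eq

Links : ∀ {n} → Graph n → Fin n → Fin n → Fin n → Set
Links G c p q = G c p ≡ true × (G c q ≡ true × p ≢ q ⊎ G p q ≡ true × c ≢ q)

pathThrough-sound : ∀ {n} (G : Graph n) c S {p q} → pathThrough G c S ≡ just (p , q) →
  Links G c p q × S p ≡ false × S q ≡ false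
pathThrough-sound G c S eq
  with p , eq ← firstJust-sound _ eq
  with g , eq ← guard-just (G c p ∧ not (S p)) eq
  with cp , p∉ ← ∧-true {G c p} g
  with q , eq ← firstJust-sound _ eq
  with g , refl ← guard-just (not (S q) ∧ linksᵇ G c p q) eq
  with q∉ , l ← ∧-true {not (S q)} g
  with ∨-true {G c q ∧ not (eqᵇ p q)} l
... | inj₁ l with cq , p≢q ← ∧-true {G c q} l =
  (cp , inj₁ (cq , ¬eqᵇ⇒≢ p≢q)) , ¬true⇒false (not-true p∉) , ¬true⇒false (not-true q∉)
... | inj₂ l with pq , c≢q ← ∧-true {G p q} l =
  (cp , inj₂ (pq , ¬eqᵇ⇒≢ c≢q)) , ¬true⇒false (not-true p∉) , ¬true⇒false (not-true q∉)

Survives : ∀ {n} → Graph n → Fin n → (Fin n → Bool) → ∀ {k} → (Fin k → Fin n) → Set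
Survives G c S A = ∃₂ λ p q → Links G c p q × (S p ≡ false × S q ≡ false) × (∀ i → p ≢ A i × q ≢ A i)

survives-punch : ∀ {n} {G : Graph n} {c S k} (A : Fin (suc k) → Fin n) i →
  Survives G c (λ v → eqᵇ v (A i) ∨ S v) (A ∘ punchIn i) → Survives G c S A
survives-punch A i (p , q , l , (p∉ , q∉) , pq∉) =
  p , q , l , (proj₂ (∨-false p∉) , proj₂ (∨-false q∉)) ,
  λ j → at p (proj₁ (∨-false p∉)) (proj₁ ∘ pq∉) j , at q (proj₁ (∨-false q∉)) (proj₂ ∘ pq∉) j
  where
  ∨-false : ∀ {a b} → a ∨ b ≡ false → a ≡ false × b ≡ false
  ∨-false {false} eq = refl , eq
  at : ∀ v → eqᵇ v (A i) ≡ false → (∀ j → v ≢ A (punchIn i j)) → ∀ j → v ≢ A j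
  at v v≢ rest j eq with i ≟F j
  ... | yes refl = true≢false (eqᵇ-refl v) (trans (cong (eqᵇ v) eq) v≢)
  ... | no i≢j   = rest (punchOut i≢j) (trans eq (cong A (sym (punchIn-punchOut i≢j))))

-- If the path found avoids `A`, it survives. Otherwise some `A i` lies on it; that vertex moves
-- from `A` to `S`, which is the corresponding branch of the search.
survivesᵇ-sound : ∀ {n} (G : Graph n) c k S → survivesᵇ G c k S ≡ true → (A : Fin k → Fin n) → Survives G c S A
survivesᵇ-sound G c k S ok A with pathThrough G c S in found
survivesᵇ-sound G c zero S ok A | just (p , q) with l , p∉ , q∉ ← pathThrough-sound G c S found =
  p , q , l , (p∉ , q∉) , λ ()
survivesᵇ-sound G c (suc k) S ok A | just (p , q) with any? (λ i → p ≟F A i) | any? (λ i → q ≟F A i)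
... | yes (i , refl) | _ = survives-punch {S = S} A i (survivesᵇ-sound G c k _ (proj₁ (∧-true ok)) (A ∘ punchIn i))
... | no _ | yes (i , refl) =
    survives-punch {S = S} A i (survivesᵇ-sound G c k _ (proj₂ (∧-true {survivesᵇ G c k _} ok)) (A ∘ punchIn i))
... | no p∉A | no q∉A with l , p∉ , q∉ ← pathThrough-sound G c S found =
  p , q , l , (p∉ , q∉) , λ i → (λ eq → p∉A (i , eq)) , (λ eq → q∉A (i , eq))

embeds-robust : ∀ {m n} {G : Graph n} {T : Tree m} {e} → IsSimple G → Embeds T G e → ∀ c →
    robustᵇ (treeG T) c ≡ true → Robust G (e c)
embeds-robust {m} {n} {G} {T} {e} (symm , _) (embedding inj edge) c ok A@(x , y , z) c∉ = result
  where
  pre : ∀ v → ∃ λ i → ∀ j → e j ≡ v → j ≡ i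
  pre v with any? (λ i → e i ≟F v)
  ... | yes (i , refl) = i , λ j → inj
  -- A vertex outside the image forbids nothing in the tree, so any default will do.
  ... | no none        = c , λ j eq → ⊥-elim (none (j , eq))
  I : Fin 3 → Fin m
  I = proj₁ (pre x) ◂ proj₁ (pre y) ◂ proj₁ (pre z) ◂ ◇
  avoid : ∀ {i} → (∀ k → i ≢ I k) → ¬ (e i ∈₃ A)
  avoid i∉ (inj₁ eq)        = i∉ 0F (proj₂ (pre x) _ eq)
  avoid i∉ (inj₂ (inj₁ eq)) = i∉ 1F (proj₂ (pre y) _ eq)
  avoid i∉ (inj₂ (inj₂ eq)) = i∉ 2F (proj₂ (pre z) _ eq)
  result : ∃ λ B → P₃ G B × Disjoint A B
  result with survivesᵇ-sound (treeG T) c 3 (λ _ → false) ok I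
  ... | p , q , (cp , inj₁ (cq , p≢q)) , _ , pq∉ =
    (e p , e c , e q) , (trans (symm _ _) (edge _ _ cp) , edge _ _ cq , p≢q ∘ inj) ,
    ∉⇒Disjoint (avoid (proj₁ ∘ pq∉)) c∉ (avoid (proj₂ ∘ pq∉))
  ... | p , q , (cp , inj₂ (pq , c≢q)) , _ , pq∉ =
    (e c , e p , e q) , (edge _ _ cp , edge _ _ pq , c≢q ∘ inj) ,
    ∉⇒Disjoint c∉ (avoid (proj₁ ∘ pq∉)) (avoid (proj₂ ∘ pq∉))

splits : ℕ → ∀ {m} → Tree m → Bool
splits zero    T = false
splits (suc k) T = disjointP₃sᵇ (treeG T) (some T) ∨ (anyᵇ (robustᵇ (treeG T)) ∨ allᵇ (λ p → splits k (leaf p T)))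

splits-fuel : ∀ {k m} {T : Tree m} → splits k T ≡ true → 1 ≤ k
splits-fuel {suc k} _ = s≤s z≤n

-- Fuel `k` inspects trees of orders m to m + k - 1, hence at most n. A successful check on an
-- extension needs positive fuel, so a vertex to extend by is still available.
splits-sound : ∀ k {m n} {G : Graph n} {T : Tree m} {e} → IsSimple G → Connected G → k + m ≤ suc n → Embeds T G e →
  splits k T ≡ true → DisjointP₃s G ⊎ ∃ (Robust G)
splits-sound (suc k) {m} {n} {T = T} {e} simple conn (s≤s k+m≤n) emb eq
  with ∨-true {disjointP₃sᵇ (treeG T) (some T)} eq
... | inj₁ disj = inj₁ (embeds-disjointP₃s emb (disjointP₃sᵇ-sound (treeG T) (some T) disj))
... | inj₂ eq with ∨-true {anyᵇ (robustᵇ (treeG T))} eq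
... | inj₁ rob with c , rob ← anyᵇ-sound _ rob = inj₂ (e c , embeds-robust simple emb c rob)
... | inj₂ eq with k≥1 ← splits-fuel {k} (allᵇ-sound (λ p → splits k (leaf p T)) eq (some T))
  with p , x , emb' ← grow simple conn emb (ℕ.≤-trans (ℕ.+-monoˡ-≤ m k≥1) k+m≤n)
  = splits-sound k simple conn (subst (_≤ suc n) (sym (ℕ.+-suc k m)) (s≤s k+m≤n)) emb'
      (allᵇ-sound (λ p → splits k (leaf p T)) eq p)

-- The finite search, run by evaluation. It stops at trees of order nine, which is a reason for
-- assuming `9 ≤ n`.
splits-root : splits 9 root ≡ true
splits-root = refl

-- Centres.

IsCentre : ∀ {n} → Graph n → Fin n → Set
IsCentre G c = ∀ v x y → v ≢ c → x ≢ c → y ≢ c → G v x ≡ true → G v y ≡ true → x ≡ y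

abstract
  disjointP₃s-or-robust : ∀ {n} {G : Graph n} → 9 ≤ n → IsSimple G → Connected G → DisjointP₃s G ⊎ ∃ (Robust G)
  disjointP₃s-or-robust {suc n} 9≤n simple conn =
    splits-sound 9 {T = root} {e = zero ◂ ◇} simple conn (s≤s 9≤n)
        (embedding (λ { {zero} {zero} _ → refl }) λ _ _ ()) splits-root

-- A robust vertex that is not a centre leaves a path P₃ in G - c, and robustness yields a second
-- path disjoint from it.
centre-or-disjointP₃s : ∀ {n} {G : Graph n} → 9 ≤ n → IsSimple G → Connected G → ∃ (IsCentre G) ⊎ DisjointP₃s G
centre-or-disjointP₃s {n} {G} 9≤n simple@(symm , irr) conn with disjointP₃s-or-robust 9≤n simple conn
... | inj₁ disj = inj₂ disj
... | inj₂ (c , robust)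
  with any? (λ v → any? (λ x → any?
      (λ y → ¬? (c ∈₃? (x , v , y)) ×-dec G x v Bool.≟ true ×-dec G v y Bool.≟ true ×-dec ¬? (x ≟F y))))
... | yes (v , x , y , c∉ , p₃) with B , p₃' , disj ← robust (x , v , y) c∉ = inj₂ ((x , v , y) , B , p₃ , p₃' , disj)
... | no none = inj₁ (c , λ v x y v≢c x≢c y≢c vx vy → decidable-stable (x ≟F y) λ x≢y →
    none (v , x , y , (λ { (inj₁ eq) → x≢c (sym eq) ; (inj₂ (inj₁ eq)) → v≢c (sym eq) ; (inj₂ (inj₂ eq)) → y≢c (sym eq) }) ,
      trans (symm _ _) vx , vy , x≢y))

-- Graphs with two disjoint paths

record AdjacentP₃s {n} (G : Graph n) : Set where
  constructor adjacentP₃s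
  field
    A B  : Triple n
    pA   : P₃ G A
    pB   : P₃ G B
    disj : Disjoint A B
    u v  : Fin n
    u∈   : u ∈₃ A
    v∈   : v ∈₃ B
    edge : G u v ≡ true

P₃-neighbour : ∀ {n} {G : Graph n} {A v} → IsSimple G → P₃ G A → v ∈₃ A → ∃ λ w → w ∈₃ A × G v w ≡ true
P₃-neighbour {A = a , b , c} simple       (ab , bc , _) (inj₁ refl)        = b , inj₂ (inj₁ refl) , ab
P₃-neighbour {A = a , b , c} simple       (ab , bc , _) (inj₂ (inj₁ refl)) = c , inj₂ (inj₂ refl) , bc
P₃-neighbour {A = a , b , c} (symm , _) (ab , bc , _) (inj₂ (inj₂ refl)) = b , inj₂ (inj₁ refl) , trans (symm _ _) bc

-- Slide the path B along a walk towards A.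
adjacent-along : ∀ {n} {G : Graph n} {A} B {u v} → IsSimple G → P₃ G A → P₃ G B → Disjoint A B → Reach G u v →
    u ∈₃ A → v ∈₃ B →
  AdjacentP₃s G
adjacent-along B simple pA pB disj here u∈ v∈ = ⊥-elim (disj _ u∈ v∈)
adjacent-along {A = A} B simple pA pB disj (step {w} {v} r wv) u∈ v∈ with w ∈₃? A | w ∈₃? B
... | yes w∈A | _       = adjacentP₃s A B pA pB disj w v w∈A v∈ wv
... | no _    | yes w∈B = adjacent-along B simple pA pB disj r u∈ w∈B
... | no w∉A  | no w∉B with v' , v'∈ , vv' ← P₃-neighbour simple pB v∈ =
  -- The walk has left both paths: w - v - v', with `v'` a neighbour of `v` on `B`, is still
  -- disjoint from `A` and meets the walk one step earlier.
  adjacent-along (w , v , v') simple pA (wv , vv' , λ { refl → w∉B v'∈ })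
    (∉⇒Disjoint w∉A (λ v∈A → disj _ v∈A v∈) (λ v'∈A → disj _ v'∈A v'∈)) r u∈ (inj₁ refl)

DisjointP₃s⇒AdjacentP₃s : ∀ {n} {G : Graph n} → IsSimple G → Connected G → DisjointP₃s G → AdjacentP₃s G
DisjointP₃s⇒AdjacentP₃s simple conn ((a , _) , B@(x , _) , pA , pB , disj) =
  adjacent-along B simple pA pB disj (conn a x) (inj₁ refl) (inj₁ refl)

-- A path P₃ on the vertex set A seen from its vertex u: u is an end of it if s holds, and its middle otherwise.
record From {n} (G : Graph n) (A : Triple n) (u : Fin n) : Set where
  constructor from
  field
    s     : Bool
    y z   : Fin n
    y∈    : y ∈₃ A
    z∈    : z ∈₃ A
    u≢y   : u ≢ y
    u≢z   : u ≢ z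
    y≢z   : y ≢ z
    uy    : G u y ≡ true
    third : G (if s then y else u) z ≡ true

adjacent⇒≢ : ∀ {n} {G : Graph n} {u v} → IsSimple G → G u v ≡ true → u ≢ v
adjacent⇒≢ (_ , irr) uv refl = true≢false uv (irr _)

P₃-from : ∀ {n} {G : Graph n} {A u} → IsSimple G → P₃ G A → u ∈₃ A → From G A u
P₃-from {G = G} {a , b , c} simple@(symm , _) (ab , bc , a≢c) u∈ = view u∈
  where
  ba = trans (symm b a) ab
  cb = trans (symm c b) bc
  view : ∀ {u} → u ∈₃ (a , b , c) → From G (a , b , c) u
  view (inj₁ refl)        =
      from true b c (inj₂ (inj₁ refl)) (inj₂ (inj₂ refl)) (adjacent⇒≢ simple ab) a≢c (adjacent⇒≢ simple bc) ab bc
  view (inj₂ (inj₁ refl)) =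
      from false a c (inj₁ refl) (inj₂ (inj₂ refl)) (adjacent⇒≢ simple ba) (adjacent⇒≢ simple bc) a≢c ba bc
  view (inj₂ (inj₂ refl)) =
      from true b a (inj₂ (inj₁ refl)) (inj₁ refl) (adjacent⇒≢ simple cb) (a≢c ∘ sym) (adjacent⇒≢ simple ba) cb ba

hang : ∀ {m} → Bool → Tree (suc m) → Fin (suc m) → Tree (3 + m)
hang s T p = leaf (if s then zero else suc p) (leaf p T)

-- The vertex `u` of the first path is the root, at position 2 after two leaves. The leaf hung there
-- is `v`, at position 0, and carries the second path.
seed : Bool → Bool → Tree 6
seed s t = hang t (leaf 2F (hang s root 0F)) 0F

embeds-hang : ∀ {m n} {G : Graph n} {T : Tree (suc m)} {e A} → IsSimple G → Embeds T G e → ∀ p → (f : From G A (e p)) →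
  (∀ i → e i ≢ From.y f) → (∀ i → e i ≢ From.z f) → Embeds (hang (From.s f) T p) G (From.z f ◂ From.y f ◂ e)
embeds-hang {G = G} {e = e} simple emb p (from s y z y∈ z∈ u≢y u≢z y≢z uy third) y∉ z∉ =
  embeds-leaf simple (embeds-leaf simple emb p y∉ uy) (if s then zero else suc p) z∉' (attach s third)
  where
  z∉' : ∀ i → (y ◂ e) i ≢ z
  z∉' zero    = y≢z
  z∉' (suc i) = z∉ i
  attach : ∀ s → G (if s then y else e p) z ≡ true → G ((y ◂ e) (if s then zero else suc p)) z ≡ true
  attach true  eq = eq
  attach false eq = eq

embeds-seed : ∀ {n} {G : Graph n} → IsSimple G → AdjacentP₃s G → ∃ λ s → ∃₂ λ t e → Embeds (seed s t) G e
embeds-seed {n} {G} simple (adjacentP₃s A B pA pB disj u v u∈ v∈ uv) =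
  From.s fA , From.s fB , _ ,
  embeds-hang simple
    (embeds-leaf simple (embeds-hang simple base 0F fA (λ { 0F → From.u≢y fA }) (λ { 0F → From.u≢z fA })) 2F (∉A v∈) uv)
    0F fB
    (λ { 0F → From.u≢y fB ; (suc i) → ∉A (From.y∈ fB) i }) (λ { 0F → From.u≢z fB ; (suc i) → ∉A (From.z∈ fB) i })
  where
  fA = P₃-from simple pA u∈
  fB = P₃-from simple pB v∈
  base : Embeds root G (u ◂ ◇)
  base = embedding (λ { {0F} {0F} _ → refl }) λ _ _ ()
  ∉A : ∀ {w} → w ∈₃ B → ∀ i → (From.z fA ◂ From.y fA ◂ u ◂ ◇) i ≢ w
  ∉A w∈ 0F refl = disj _ (From.z∈ fA) w∈
  ∉A w∈ 1F refl = disj _ (From.y∈ fA) w∈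
  ∉A w∈ 2F refl = disj _ u∈ w∈

2^n<h : ∀ n → 2 ^ n < h (suc n)
2^n<h n with isOdd (suc n)
... | true  = ℕ.m<m+n (2 ^ n) (ℕ.*-mono-≤ {1} {suc n + 9} {1} (s≤s z≤n) (ℕ.m^n>0 2 ((suc n ∸ 7) / 2)))
... | false = ℕ.m<m+n (2 ^ n) (ℕ.*-mono-≤ {1} {suc n + 12} {1} (s≤s z≤n) (ℕ.m^n>0 2 ((suc n ∸ 8) / 2)))

embeds-spanning : ∀ {n} {G : Graph n} {T : Tree n} {e} → Embeds T G e → d G ≤ d (treeG T)
embeds-spanning {T = T} {e} (embedding inj edge) = d-antitone {H = treeG T} e inj edge

-- Each new vertex at most doubles the count, by `d-delete₀`, so the bound carries over from the
-- tree to a spanning tree.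
half-dense : ∀ k {m n} {G : Graph n} {T : Tree (suc m)} {e} → IsSimple G → Connected G → k + suc m ≡ n → Embeds T G e →
  d (treeG T) ≤ 2 ^ m → d G ≤ 2 ^ (n ∸ 1)
half-dense zero {T = T} simple conn refl emb small = ℕ.≤-trans (embeds-spanning {T = T} emb) small
half-dense (suc k) {m} {T = T} simple conn refl emb small
  with p , x , emb' ← grow simple conn emb (s≤s (ℕ.m≤n+m (suc m) k)) =
  half-dense k simple conn (ℕ.+-suc k (suc m)) emb'
    (ℕ.≤-trans (d-delete₀ (treeG (leaf p T)))
        (ℕ.≤-trans (ℕ.+-mono-≤ small small) (ℕ.≤-reflexive (cong (2 ^ m +_) (sym (ℕ.+-identityʳ (2 ^ m)))))))

total₁ : ∀ {m} → Tree m → ℕ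
total₁ {m} T = total T (Vec.replicate m (wt 1 1 1))

-- A tree with at most 2 ^ (m - 1) dissociation sets needs no further growth, by half-dense.
sparse : ℕ → ∀ {m} → Tree m → Bool
sparse zero    T = false
sparse (suc k) {m} T = (total₁ T ≤ᵇ 2 ^ (m ∸ 1)) ∨ (((m <ᵇ 9) ∨ (total₁ T <ᵇ h m)) ∧ allᵇ (λ p → sparse k (leaf p T)))

-- A tree that is not small enough for `half-dense` either can grow or spans `G`. In the latter case
-- its order is at least 9, so the search has compared its count with `h`.
sparse-sound : ∀ k {m n} {G : Graph n} {T : Tree (suc m)} {e} → IsSimple G → Connected G → 9 ≤ n → Embeds T G e →
  sparse k T ≡ true → d G < h n
sparse-sound (suc k) {m} {zero} simple conn ()
sparse-sound (suc k) {m} {suc n} {T = T} {e} simple conn 9≤n emb@(embedding inj _) eq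
  with ∨-true {total₁ T ≤ᵇ 2 ^ m} eq
... | inj₁ small = ℕ.≤-<-trans
  (half-dense (n ∸ m) simple conn (trans (ℕ.+-suc (n ∸ m) m) (cong suc (ℕ.m∸n+n≡m (ℕ.≤-pred (injective⇒≤ inj))))) emb
    (ℕ.≤-trans (d-tree≤total T) (ℕ.≤ᵇ⇒≤ _ _ (Equivalence.from Bool.T-≡ small))))
  (2^n<h n)
... | inj₂ eq with ok , rec ← ∧-true {(suc m <ᵇ 9) ∨ (total₁ T <ᵇ h (suc m))} eq with suc m <? suc n
... | yes m<n with p , x , emb' ← grow simple conn emb m<n =
    sparse-sound k simple conn 9≤n emb' (allᵇ-sound (λ p → sparse k (leaf p T)) rec p)
... | no m≮n with refl ← ℕ.≤-antisym (injective⇒≤ inj) (ℕ.≮⇒≥ m≮n) with ∨-true {suc m <ᵇ 9} ok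
... | inj₁ m<9 = ⊥-elim (ℕ.<⇒≱ (ℕ.<ᵇ⇒< _ _ (Equivalence.from Bool.T-≡ m<9)) 9≤n)
... | inj₂ <h = ℕ.≤-<-trans (ℕ.≤-trans (embeds-spanning {T = T} emb) (d-tree≤total T))
    (ℕ.<ᵇ⇒< _ _ (Equivalence.from Bool.T-≡ <h))

-- Run by evaluation. Fuel 6 covers orders six to eleven, and at order eleven only the bound 2 ^ 10
-- can end the search.
sparse-seed : ∀ s t → sparse 6 (seed s t) ≡ true
sparse-seed true  true  = refl
sparse-seed true  false = refl
sparse-seed false true  = refl
sparse-seed false false = refl

abstract
  disjointP₃s⇒d<h : ∀ {n} {G : Graph n} → 9 ≤ n → IsSimple G → Connected G → DisjointP₃s G → d G < h n
  disjointP₃s⇒d<h 9≤n simple conn disj with s , t , e , emb ← embeds-seed simple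
      (DisjointP₃s⇒AdjacentP₃s simple conn disj)
    = sparse-sound 6 {T = seed s t} {e = e} simple conn 9≤n emb (sparse-seed s t)

-- Stars

infixr 5 pendant_

-- The legs of a star: a single vertex joined to the centre, or an edge one of whose ends
-- is joined to the centre and whose other end is so if the flag is set.
data Legs : ℕ → Set where
  []       : Legs 0
  pendant_ : ∀ {m} → Legs m → Legs (1 + m)
  pair     : ∀ {m} → Bool → Legs m → Legs (2 + m)

linked : ∀ {m} → Legs m → Fin m → Bool
linked (pendant L) zero          = true
linked (pendant L) (suc i)       = linked L i
linked (pair t L)  zero          = true
linked (pair t L)  (suc zero)    = t
linked (pair t L)  (suc (suc i)) = linked L i

legG : ∀ {m} → Legs m → Graph m
legG (pendant L) zero          _             = false
legG (pendant L) (suc i)       zero          = false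
legG (pendant L) (suc i)       (suc j)       = legG L i j
legG (pair t L)  zero          zero          = false
legG (pair t L)  zero          (suc zero)    = true
legG (pair t L)  zero          (suc (suc j)) = false
legG (pair t L)  (suc zero)    zero          = true
legG (pair t L)  (suc zero)    (suc j)       = false
legG (pair t L)  (suc (suc i)) zero          = false
legG (pair t L)  (suc (suc i)) (suc zero)    = false
legG (pair t L)  (suc (suc i)) (suc (suc j)) = legG L i j

starG : ∀ {m} → Legs m → Graph (suc m)
starG L zero    zero    = false
starG L zero    (suc j) = linked L j
starG L (suc i) zero    = linked L i
starG L (suc i) (suc j) = legG L i j

suc² : ∀ {n} → Fin n → Fin (suc (suc n))
suc² i = suc (suc i)

suc-inj² : ∀ {n} {i j : Fin n} → suc² i ≡ suc² j → i ≡ j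
suc-inj² refl = refl

legG-unique : ∀ {m} (L : Legs m) {v x y} → legG L v x ≡ true → legG L v y ≡ true → x ≡ y
legG-unique (pendant L) {suc v} {suc x} {suc y} vx vy = cong suc (legG-unique L vx vy)
legG-unique (pair t L) {zero} {suc zero} {suc zero} vx vy = refl
legG-unique (pair t L) {suc zero} {zero} {zero} vx vy = refl
legG-unique (pair t L) {suc (suc v)} {suc (suc x)} {suc (suc y)} vx vy = cong suc² (legG-unique L vx vy)

-- Isomorphism of graphs whose orders need not be equal by computation; _≅_ is the case m = n.
record Iso {m n} (G : Graph m) (H : Graph n) : Set where
  constructor iso
  field
    σ   : Permutation m n
    adj : ∀ u v → G u v ≡ H (σ ⟨$⟩ʳ u) (σ ⟨$⟩ʳ v)

iso⇒≅ : ∀ {n} {G H : Graph n} → Iso G H → G ≅ H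
iso⇒≅ (iso σ adj) = σ , adj

≅⇒iso : ∀ {n} {G H : Graph n} → G ≅ H → Iso G H
≅⇒iso (σ , adj) = iso σ adj

iso-sym : ∀ {m n} {G : Graph m} {H : Graph n} → Iso G H → Iso H G
iso-sym {H = H} (iso σ adj) = iso (flip σ) λ u v → sym (trans (adj _ _) (cong₂ H (inverseʳ σ) (inverseʳ σ)))

iso-trans : ∀ {l m n} {F : Graph l} {G : Graph m} {H : Graph n} → Iso F G → Iso G H → Iso F H
iso-trans (iso σ adj) (iso τ adj') = iso (σ ∘ₚ τ) λ u v → trans (adj u v) (adj' _ _)

iso-order : ∀ {m n} {G : Graph m} {H : Graph n} → Iso G H → m ≡ n
iso-order (iso σ _) = ↔⇒≡ σ

⟨$⟩ʳ-inj : ∀ {m n} (σ : Permutation m n) → Inj (σ ⟨$⟩ʳ_)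
⟨$⟩ʳ-inj σ {x} {y} eq = trans (sym (inverseˡ σ)) (trans (cong (σ ⟨$⟩ˡ_) eq) (inverseˡ σ))

d-iso : ∀ {m n} {G : Graph m} {H : Graph n} → Iso G H → d G ≡ d H
d-iso i with refl ← iso-order i = ℕ.≤-antisym (d-iso-≤ (iso-sym i)) (d-iso-≤ i)
  where
  d-iso-≤ : ∀ {n} {G H : Graph n} → Iso G H → d H ≤ d G
  d-iso-≤ (iso σ adj) = d-antitone (σ ⟨$⟩ʳ_) (⟨$⟩ʳ-inj σ) λ i j → trans (sym (adj i j))

injective⇒iso : ∀ {n} {G H : Graph n} (e : Fin n → Fin n) → Inj e → (∀ i j → G i j ≡ H (e i) (e j)) → Iso G H
injective⇒iso e inj = iso (permutation e (proj₁ ∘ surj) (proj₂ ∘ surj) (λ i → inj (proj₂ (surj (e i)))))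
  where surj = injective⇒surjective inj

-- By closed, an edge leaving the legs found so far starts at c.
record PartialStar {n} (G : Graph n) (c : Fin n) {m} (L : Legs m) (e : Fin m → Fin n) : Set where
  constructor partialStar
  field
    inj    : Inj e
    ≢c     : ∀ i → e i ≢ c
    links  : ∀ i → linked L i ≡ G c (e i)
    adj    : ∀ i j → legG L i j ≡ G (e i) (e j)
    closed : ∀ i x → G (e i) x ≡ true → x ≡ c ⊎ ∃ λ j → e j ≡ x

-- By `closed`, an edge leaving the part found so far starts at `c`. If its end `x` has a neighbour
-- `y` other than `c`, then `y` is the only one because `c` is a centre, and x - y is a new leg;
-- otherwise `x` is pendant.
add-leg : ∀ {n} {G : Graph n} {c m} {L : Legs m} {e} → IsSimple G → Connected G → IsCentre G c →
    PartialStar G c L e → suc m < n →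
  (∃ λ x → PartialStar G c (pendant L) (x ◂ e)) ⊎ (∃ λ t → ∃₂ λ x y → PartialStar G c (pair t L) (x ◂ y ◂ e))
add-leg {n} {G} {c} {m} {L} {e} (symm , irr) conn centre (partialStar inj ≢c links adj closed) m<n
  with exit conn (c ◂ e) zero m<n
... | suc i , x , ix , x∉ with closed i x ix
...   | inj₁ refl    = ⊥-elim (x∉ zero refl)
...   | inj₂ (j , eq) = ⊥-elim (x∉ (suc j) eq)
add-leg {n} {G} {c} {m} {L} {e} (symm , irr) conn centre (partialStar inj ≢c links adj closed) m<n
  | zero , x , cx , x∉ with any? (λ y → ¬? (y ≟F c) ×-dec (G x y Bool.≟ true))
... | no none = inj₁ (x , partialStar (◂-inj inj (x∉ ∘ suc)) ≢c' links' adj' closed')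
  where
  x≢c : x ≢ c
  x≢c eq = x∉ zero (sym eq)
  x-only : ∀ y → G x y ≡ true → y ≡ c
  x-only y xy = decidable-stable (y ≟F c) λ y≢c → none (y , y≢c , xy)
  x-apart : ∀ j → false ≡ G x (e j)
  x-apart j = sym (¬true⇒false (≢c j ∘ x-only (e j)))
  ≢c' : ∀ i → (x ◂ e) i ≢ c
  ≢c' zero    = x≢c
  ≢c' (suc i) = ≢c i
  links' : ∀ i → linked (pendant L) i ≡ G c ((x ◂ e) i)
  links' zero    = sym cx
  links' (suc i) = links i
  adj' : ∀ i j → legG (pendant L) i j ≡ G ((x ◂ e) i) ((x ◂ e) j)
  adj' zero    zero    = sym (irr x)
  adj' zero    (suc j) = x-apart j
  adj' (suc i) zero    = trans (x-apart i) (symm _ _)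
  adj' (suc i) (suc j) = adj i j
  closed' : ∀ i y → G ((x ◂ e) i) y ≡ true → y ≡ c ⊎ ∃ λ j → (x ◂ e) j ≡ y
  closed' zero    y xy = inj₁ (x-only y xy)
  closed' (suc i) y iy = [ inj₁ , (λ { (j , eq) → inj₂ (suc j , eq) }) ]′ (closed i y iy)
... | yes (y , y≢c , xy) = inj₂ (G c y , x , y , partialStar (◂-inj (◂-inj inj y∉) x∉') ≢c' links' adj' closed')
  where
  x≢c : x ≢ c
  x≢c eq = x∉ zero (sym eq)
  yx = trans (symm y x) xy
  apart : ∀ {v} → v ≢ c → (∀ j → e j ≢ v) → ∀ j → false ≡ G v (e j)
  apart {v} v≢c v∉ j = sym (¬true⇒false λ vj → [ v≢c , (λ { (k , eq) → v∉ k eq }) ]′ (closed j v (trans (symm _ _) vj)))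
  y∉ : ∀ i → e i ≢ y
  y∉ i refl with closed i x yx
  ... | inj₁ eq       = x≢c eq
  ... | inj₂ (j , eq) = x∉ (suc j) eq
  y≢x : y ≢ x
  y≢x refl = true≢false xy (irr x)
  x∉' : ∀ i → (y ◂ e) i ≢ x
  x∉' zero    = y≢x
  x∉' (suc i) = x∉ (suc i)
  ≢c' : ∀ i → (x ◂ y ◂ e) i ≢ c
  ≢c' zero          = x≢c
  ≢c' (suc zero)    = y≢c
  ≢c' (suc (suc i)) = ≢c i
  links' : ∀ i → linked (pair (G c y) L) i ≡ G c ((x ◂ y ◂ e) i)
  links' zero          = sym cx
  links' (suc zero)    = refl
  links' (suc (suc i)) = links i
  x-apart = apart x≢c (x∉ ∘ suc)
  y-apart = apart y≢c y∉
  adj' : ∀ i j → legG (pair (G c y) L) i j ≡ G ((x ◂ y ◂ e) i) ((x ◂ y ◂ e) j)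
  adj' zero          zero          = sym (irr x)
  adj' zero          (suc zero)    = sym xy
  adj' zero          (suc (suc j)) = x-apart j
  adj' (suc zero)    zero          = sym yx
  adj' (suc zero)    (suc zero)    = sym (irr y)
  adj' (suc zero)    (suc (suc j)) = y-apart j
  adj' (suc (suc i)) zero          = trans (x-apart i) (symm _ _)
  adj' (suc (suc i)) (suc zero)    = trans (y-apart i) (symm _ _)
  adj' (suc (suc i)) (suc (suc j)) = adj i j
  closed' : ∀ i z → G ((x ◂ y ◂ e) i) z ≡ true → z ≡ c ⊎ ∃ λ j → (x ◂ y ◂ e) j ≡ z
  closed' zero z xz with z ≟F c
  ... | yes eq = inj₁ eq
  ... | no z≢c = inj₂ (suc zero , centre x y z x≢c y≢c z≢c xy xz)
  closed' (suc zero) z yz with z ≟F c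
  ... | yes eq = inj₁ eq
  ... | no z≢c = inj₂ (zero , centre y x z y≢c x≢c z≢c yx yz)
  closed' (suc (suc i)) z iz = [ inj₁ , (λ { (j , eq) → inj₂ (suc (suc j) , eq) }) ]′ (closed i z iz)

-- Legs are added until they exhaust the vertices other than `c`; the injection built is then an
-- isomorphism. The fuel bounds the number of missing vertices.
complete-star : ∀ k {n} {G : Graph n} {c m} {L : Legs m} {e} → IsSimple G → Connected G → IsCentre G c → n ≤ k + suc m →
  PartialStar G c L e → ∃ λ m → Σ (Legs m) λ L → suc m ≡ n × Iso (starG L) G
complete-star k {n} {G} {c} {m} {L} {e} simple conn centre n≤ part with suc m <? n
complete-star zero simple conn centre n≤ part | yes m<n = ⊥-elim (ℕ.<⇒≱ m<n n≤)
complete-star (suc k) {n} {m = m} simple conn centre n≤ part | yes m<n with add-leg simple conn centre part m<n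
... | inj₁ (x , part') = complete-star k simple conn centre (subst (n ≤_) (sym (ℕ.+-suc k (suc m))) n≤) part'
... | inj₂ (t , x , y , part') = complete-star k simple conn centre
  (ℕ.≤-trans (subst (n ≤_) (sym (ℕ.+-suc k (suc m))) n≤) (ℕ.+-monoʳ-≤ k (ℕ.n≤1+n _))) part'
complete-star k {n} {G} {c} {m} {L} {e} (symm , irr) conn centre n≤ (partialStar inj ≢c links adj _) | no m≮n
  with refl ← ℕ.≤-antisym (injective⇒≤ {f = c ◂ e} (◂-inj inj ≢c)) (ℕ.≮⇒≥ m≮n) =
  m , L , refl , injective⇒iso (c ◂ e) (◂-inj inj ≢c) eq
  where
  eq : ∀ i j → starG L i j ≡ G ((c ◂ e) i) ((c ◂ e) j)
  eq zero    zero    = sym (irr c)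
  eq zero    (suc j) = links j
  eq (suc i) zero    = trans (links i) (symm _ _)
  eq (suc i) (suc j) = adj i j

centre⇒star : ∀ {n} {G : Graph n} {c} → IsSimple G → Connected G → IsCentre G c → ∃ λ m → Σ (Legs m) λ L →
    suc m ≡ n × Iso (starG L) G
centre⇒star {n} simple conn centre = complete-star n {L = []} {e = ◇} simple conn centre (ℕ.m≤m+n n 1)
  (partialStar (λ { {()} }) (λ ()) (λ ()) (λ ()) (λ ()))

-- ok L k S: the vertices S of the legs, together with the centre and, if k holds, a neighbour
-- of the centre outside L, form a dissociation set.
ok : ∀ {m} → Legs m → Bool → Subset m → Bool
ok []          k []                  = true
ok (pendant L) k (false ∷ S)         = ok L k S
ok (pendant L) k (true ∷ S)          = not k ∧ ok L true S
ok (pair t L)  k (false ∷ false ∷ S) = ok L k S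
ok (pair t L)  k (false ∷ true ∷ S)  = if t then not k ∧ ok L true S else ok L k S
ok (pair t L)  k (true ∷ false ∷ S)  = not k ∧ ok L true S
ok (pair t L)  k (true ∷ true ∷ S)   = false

-- The condition at the chosen centre is `free` and `one`, that at its chosen neighbours `alone`.
-- Other vertices have at most one neighbour anyway.
record Ok {m} (L : Legs m) (k : Bool) (S : Subset m) : Set where
  constructor mkOk
  field
    free  : ∀ i → linked L i ≡ true → lookup S i ≡ true → k ≡ false
    one   : ∀ i j → linked L i ≡ true → linked L j ≡ true → lookup S i ≡ true → lookup S j ≡ true → i ≡ j
    alone : ∀ i j → linked L i ≡ true → lookup S i ≡ true → lookup S j ≡ true → legG L i j ≡ true → ⊥

ok-complete : ∀ {m} (L : Legs m) k S → Ok L k S → ok L k S ≡ true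
ok-complete []          k []                  _ = refl
ok-complete (pendant L) k (false ∷ S) (mkOk free one alone) = ok-complete L k S
  (mkOk (free ∘ suc) (λ i j li lj i∈ j∈ → suc-injective (one (suc i) (suc j) li lj i∈ j∈))
      (λ i j → alone (suc i) (suc j)))
ok-complete (pendant L) k (true ∷ S) (mkOk free one alone) rewrite free zero refl refl = ok-complete L true S
  (mkOk (λ i li i∈ → ⊥-elim (0≢suc (one zero (suc i) refl li refl i∈)))
      (λ i j li lj i∈ j∈ → suc-injective (one (suc i) (suc j) li lj i∈ j∈)) (λ i j → alone (suc i) (suc j)))
ok-complete (pair t L)  k (false ∷ false ∷ S) (mkOk free one alone) = ok-complete L k S
  (mkOk (free ∘ suc²) (λ i j li lj i∈ j∈ → suc-inj² (one (suc² i) (suc² j) li lj i∈ j∈))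
      (λ i j → alone (suc (suc i)) (suc (suc j))))
ok-complete (pair false L)  k (false ∷ true ∷ S) (mkOk free one alone) = ok-complete L k S
  (mkOk (free ∘ suc²) (λ i j li lj i∈ j∈ → suc-inj² (one (suc² i) (suc² j) li lj i∈ j∈))
      (λ i j → alone (suc (suc i)) (suc (suc j))))
ok-complete (pair true L)  k (false ∷ true ∷ S) (mkOk free one alone) rewrite free (suc zero) refl refl =
    ok-complete L true S
  (mkOk (λ i li i∈ → ⊥-elim (0≢suc (suc-injective (one (suc zero) (suc (suc i)) refl li refl i∈))))
      (λ i j li lj i∈ j∈ → suc-inj² (one (suc² i) (suc² j) li lj i∈ j∈)) (λ i j → alone (suc (suc i)) (suc (suc j))))
ok-complete (pair t L)  k (true ∷ false ∷ S) (mkOk free one alone) rewrite free zero refl refl = ok-complete L true S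
  (mkOk (λ i li i∈ → ⊥-elim (0≢suc (one zero (suc (suc i)) refl li refl i∈)))
      (λ i j li lj i∈ j∈ → suc-inj² (one (suc² i) (suc² j) li lj i∈ j∈)) (λ i j → alone (suc (suc i)) (suc (suc j))))
ok-complete (pair t L)  k (true ∷ true ∷ S) (mkOk free one alone) = ⊥-elim (alone zero (suc zero) refl refl refl refl)

ok-sound : ∀ {m} (L : Legs m) k S → ok L k S ≡ true → Ok L k S
ok-sound []          k []                  _ = mkOk (λ ()) (λ ()) (λ ())
ok-sound (pendant L) k (false ∷ S) eq with mkOk free one alone ← ok-sound L k S eq = mkOk
  (λ { (suc i) → free i })
  (λ { (suc i) (suc j) li lj i∈ j∈ → cong suc (one i j li lj i∈ j∈) })
  (λ { (suc i) (suc j) → alone i j })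
ok-sound (pendant L) false (true ∷ S) eq with mkOk free one alone ← ok-sound L true S eq = mkOk
  (λ _ _ _ → refl)
  (λ { zero zero _ _ _ _ → refl
     ; zero (suc j) li lj i∈ j∈ → ⊥-elim (true≢false refl (free j lj j∈))
     ; (suc i) zero li lj i∈ j∈ → ⊥-elim (true≢false refl (free i li i∈))
     ; (suc i) (suc j) li lj i∈ j∈ → cong suc (one i j li lj i∈ j∈) })
  (λ { (suc i) (suc j) → alone i j })
ok-sound (pair t L) k (false ∷ false ∷ S) eq with mkOk free one alone ← ok-sound L k S eq = mkOk
  (λ { (suc (suc i)) → free i })
  (λ { (suc (suc i)) (suc (suc j)) li lj i∈ j∈ → cong suc² (one i j li lj i∈ j∈) })
  (λ { (suc (suc i)) (suc (suc j)) → alone i j })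
ok-sound (pair false L) k (false ∷ true ∷ S) eq with mkOk free one alone ← ok-sound L k S eq = mkOk
  (λ { (suc (suc i)) → free i })
  (λ { (suc (suc i)) (suc (suc j)) li lj i∈ j∈ → cong suc² (one i j li lj i∈ j∈) })
  (λ { (suc (suc i)) (suc (suc j)) → alone i j })
ok-sound (pair true L) false (false ∷ true ∷ S) eq with mkOk free one alone ← ok-sound L true S eq = mkOk
  (λ _ _ _ → refl)
  (λ { (suc zero) (suc zero) _ _ _ _ → refl
     ; (suc zero) (suc (suc j)) li lj i∈ j∈ → ⊥-elim (true≢false refl (free j lj j∈))
     ; (suc (suc i)) (suc zero) li lj i∈ j∈ → ⊥-elim (true≢false refl (free i li i∈))
     ; (suc (suc i)) (suc (suc j)) li lj i∈ j∈ → cong suc² (one i j li lj i∈ j∈) })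
  (λ { (suc zero) zero _ _ () ; (suc (suc i)) (suc (suc j)) → alone i j })
ok-sound (pair t L) false (true ∷ false ∷ S) eq with mkOk free one alone ← ok-sound L true S eq = mkOk
  (λ _ _ _ → refl)
  (λ { zero zero _ _ _ _ → refl
     ; zero (suc (suc j)) li lj i∈ j∈ → ⊥-elim (true≢false refl (free j lj j∈))
     ; (suc (suc i)) zero li lj i∈ j∈ → ⊥-elim (true≢false refl (free i li i∈))
     ; (suc (suc i)) (suc (suc j)) li lj i∈ j∈ → cong suc² (one i j li lj i∈ j∈) })
  (λ { zero (suc zero) _ _ () ; (suc (suc i)) (suc (suc j)) → alone i j })

-- Without the centre every set qualifies, because the legs have maximum degree one.
okStar : ∀ {m} → Legs m → Subset (suc m) → Bool
okStar L (false ∷ S) = true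
okStar L (true ∷ S)  = ok L false S

Diss⇒okStar : ∀ {m} (L : Legs m) S → Diss (starG L) S → okStar L S ≡ true
Diss⇒okStar L (false ∷ S) _ = refl
Diss⇒okStar L (true ∷ S)  h = ok-complete L false S (mkOk (λ _ _ _ → refl)
  (λ i j li lj i∈ j∈ → suc-injective (h zero (suc i) (suc j) refl i∈ j∈ li lj))
  (λ i j li i∈ j∈ ij → 0≢suc (h (suc i) zero (suc j) i∈ refl j∈ li ij)))

okStar⇒Diss : ∀ {m} (L : Legs m) S → okStar L S ≡ true → Diss (starG L) S
okStar⇒Diss L (false ∷ S) _ (suc v) (suc x) (suc y) _ _ _ vx vy = cong suc (legG-unique L vx vy)
okStar⇒Diss L (true ∷ S) eq with mkOk free one alone ← ok-sound L false S eq = diss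
  where
  diss : Diss (starG L) (true ∷ S)
  diss zero    (suc x) (suc y) _  x∈ y∈ vx vy = cong suc (one x y vx vy x∈ y∈)
  diss (suc v) zero    zero    _  _  _  _  _  = refl
  diss (suc v) zero    (suc y) v∈ _  y∈ vx vy = ⊥-elim (alone v y vx v∈ y∈ vy)
  diss (suc v) (suc x) zero    v∈ x∈ _  vx vy = ⊥-elim (alone v x vy v∈ x∈ vx)
  diss (suc v) (suc x) (suc y) _  _  _  vx vy = cong suc (legG-unique L vx vy)

-- The number of sets `S` with `ok L k S`, computed leg by leg; see `sumS-ok`.
count : ∀ {m} → Bool → Legs m → ℕ
count k     []             = 1
count true  (pendant L)    = count true L
count false (pendant L)    = count false L + count true L
count true  (pair true L)  = count true L
count false (pair true L)  = count false L + count true L + count true L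
count true  (pair false L) = count true L + count true L
count false (pair false L) = count false L + count false L + count true L

sumS-ok : ∀ {m} k (L : Legs m) → sumS m ([_] ∘ ok L k) ≡ count k L
sumS-ok k     []             = refl
sumS-ok {suc m} true  (pendant L) = trans (cong₂ _+_ (sumS-ok true L) (sumS-0 m)) (ℕ.+-identityʳ _)
sumS-ok false (pendant L)    = cong₂ _+_ (sumS-ok false L) (sumS-ok true L)
sumS-ok {suc (suc m)} true  (pair true L) =
    trans (cong₂ _+_ (cong₂ _+_ (sumS-ok true L) (sumS-0 m)) (cong₂ _+_ (sumS-0 m) (sumS-0 m)))
  (trans (ℕ.+-identityʳ _) (ℕ.+-identityʳ _))
sumS-ok {suc (suc m)} false (pair true L) =
    cong₂ _+_ (cong₂ _+_ (sumS-ok false L) (sumS-ok true L))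
        (trans (cong₂ _+_ (sumS-ok true L) (sumS-0 m)) (ℕ.+-identityʳ _))
sumS-ok {suc (suc m)} true  (pair false L) =
    trans (cong₂ _+_ (cong₂ _+_ (sumS-ok true L) (sumS-ok true L)) (cong₂ _+_ (sumS-0 m) (sumS-0 m)))
  (ℕ.+-identityʳ _)
sumS-ok {suc (suc m)} false (pair false L) =
    cong₂ _+_ (cong₂ _+_ (sumS-ok false L) (sumS-ok false L))
        (trans (cong₂ _+_ (sumS-ok true L) (sumS-0 m)) (ℕ.+-identityʳ _))

d-star : ∀ {m} (L : Legs m) → d (starG L) ≡ 2 ^ m + count false L
d-star {m} L = trans (d≡sumS (starG L) (okStar L) (Diss⇒okStar L) (okStar⇒Diss L))
    (cong₂ _+_ (sumS-1 m) (sumS-ok false L))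

-- Sorting the legs

record LegsIso {m n} (L : Legs m) (L' : Legs n) : Set where
  constructor legsIso
  field
    σ      : Permutation m n
    links  : ∀ i → linked L i ≡ linked L' (σ ⟨$⟩ʳ i)
    adj    : ∀ i j → legG L i j ≡ legG L' (σ ⟨$⟩ʳ i) (σ ⟨$⟩ʳ j)

legs-refl : ∀ {m} {L : Legs m} → LegsIso L L
legs-refl = legsIso idₚ (λ _ → refl) (λ _ _ → refl)

legs-trans : ∀ {l m n} {L : Legs l} {M : Legs m} {N : Legs n} → LegsIso L M → LegsIso M N → LegsIso L N
legs-trans (legsIso σ links adj) (legsIso τ links' adj') =
  legsIso (σ ∘ₚ τ) (λ i → trans (links i) (links' _)) (λ i j → trans (adj i j) (adj' _ _))

legs⇒star : ∀ {m n} {L : Legs m} {M : Legs n} → LegsIso L M → Iso (starG L) (starG M)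
legs⇒star {L = L} {M} (legsIso σ links adj) = iso (lift₀ σ) eq
  where
  eq : ∀ i j → starG L i j ≡ starG M (lift₀ σ ⟨$⟩ʳ i) (lift₀ σ ⟨$⟩ʳ j)
  eq zero    zero    = refl
  eq zero    (suc j) = links j
  eq (suc i) zero    = links i
  eq (suc i) (suc j) = adj i j

pendant-cong : ∀ {m n} {L : Legs m} {M : Legs n} → LegsIso L M → LegsIso (pendant L) (pendant M)
pendant-cong {L = L} {M} (legsIso σ links adj) = legsIso τ links' adj'
  where
  τ = lift₀ σ
  links' : ∀ i → linked (pendant L) i ≡ linked (pendant M) (τ ⟨$⟩ʳ i)
  links' zero    = refl
  links' (suc i) = links i
  adj' : ∀ i j → legG (pendant L) i j ≡ legG (pendant M) (τ ⟨$⟩ʳ i) (τ ⟨$⟩ʳ j)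
  adj' zero    zero    = refl
  adj' zero    (suc j) = refl
  adj' (suc i) zero    = refl
  adj' (suc i) (suc j) = adj i j

pair-cong : ∀ {m n} t {L : Legs m} {M : Legs n} → LegsIso L M → LegsIso (pair t L) (pair t M)
pair-cong t {L} {M} (legsIso σ links adj) = legsIso τ links' adj'
  where
  τ = lift₀ (lift₀ σ)
  links' : ∀ i → linked (pair t L) i ≡ linked (pair t M) (τ ⟨$⟩ʳ i)
  links' 0F            = refl
  links' 1F            = refl
  links' (suc (suc i)) = links i
  adj' : ∀ i j → legG (pair t L) i j ≡ legG (pair t M) (τ ⟨$⟩ʳ i) (τ ⟨$⟩ʳ j)
  adj' 0F            0F            = refl
  adj' 0F            1F            = refl
  adj' 0F            (suc (suc j)) = refl
  adj' 1F            0F            = refl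
  adj' 1F            1F            = refl
  adj' 1F            (suc (suc j)) = refl
  adj' (suc (suc i)) 0F            = refl
  adj' (suc (suc i)) 1F            = refl
  adj' (suc (suc i)) (suc (suc j)) = adj i j

swap-pendant-pair : ∀ {m} t (L : Legs m) → LegsIso (pendant (pair t L)) (pair t (pendant L))
swap-pendant-pair {m} t L = legsIso (permutation f g fg gf) links adj
  where
  f g : Fin (3 + m) → Fin (3 + m)
  f 0F = 2F
  f 1F = 0F
  f 2F = 1F
  f (suc (suc (suc i))) = suc (suc (suc i))
  g 0F = 1F
  g 1F = 2F
  g 2F = 0F
  g (suc (suc (suc i))) = suc (suc (suc i))
  fg : ∀ i → f (g i) ≡ i
  fg 0F = refl
  fg 1F = refl
  fg 2F = refl
  fg (suc (suc (suc i))) = refl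
  gf : ∀ i → g (f i) ≡ i
  gf 0F = refl
  gf 1F = refl
  gf 2F = refl
  gf (suc (suc (suc i))) = refl
  links : ∀ i → linked (pendant (pair t L)) i ≡ linked (pair t (pendant L)) (f i)
  links 0F = refl
  links 1F = refl
  links 2F = refl
  links (suc (suc (suc i))) = refl
  adj : ∀ i j → legG (pendant (pair t L)) i j ≡ legG (pair t (pendant L)) (f i) (f j)
  adj 0F 0F = refl
  adj 0F 1F = refl
  adj 0F 2F = refl
  adj 0F (suc (suc (suc j))) = refl
  adj 1F 0F = refl
  adj 1F 1F = refl
  adj 1F 2F = refl
  adj 1F (suc (suc (suc j))) = refl
  adj 2F 0F = refl
  adj 2F 1F = refl
  adj 2F 2F = refl
  adj 2F (suc (suc (suc j))) = refl
  adj (suc (suc (suc i))) 0F = refl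
  adj (suc (suc (suc i))) 1F = refl
  adj (suc (suc (suc i))) 2F = refl
  adj (suc (suc (suc i))) (suc (suc (suc j))) = refl

swap-pairs : ∀ {m} t u (L : Legs m) → LegsIso (pair t (pair u L)) (pair u (pair t L))
swap-pairs {m} t u L = legsIso (permutation f f ff ff) links adj
  where
  f : Fin (4 + m) → Fin (4 + m)
  f 0F = 2F
  f 1F = 3F
  f 2F = 0F
  f 3F = 1F
  f (suc (suc (suc (suc i)))) = suc (suc (suc (suc i)))
  ff : ∀ i → f (f i) ≡ i
  ff 0F = refl
  ff 1F = refl
  ff 2F = refl
  ff 3F = refl
  ff (suc (suc (suc (suc i)))) = refl
  links : ∀ i → linked (pair t (pair u L)) i ≡ linked (pair u (pair t L)) (f i)
  links 0F = refl
  links 1F = refl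
  links 2F = refl
  links 3F = refl
  links (suc (suc (suc (suc i)))) = refl
  adj : ∀ i j → legG (pair t (pair u L)) i j ≡ legG (pair u (pair t L)) (f i) (f j)
  adj 0F 0F = refl
  adj 0F 1F = refl
  adj 0F 2F = refl
  adj 0F 3F = refl
  adj 0F (suc (suc (suc (suc j)))) = refl
  adj 1F 0F = refl
  adj 1F 1F = refl
  adj 1F 2F = refl
  adj 1F 3F = refl
  adj 1F (suc (suc (suc (suc j)))) = refl
  adj 2F 0F = refl
  adj 2F 1F = refl
  adj 2F 2F = refl
  adj 2F 3F = refl
  adj 2F (suc (suc (suc (suc j)))) = refl
  adj 3F 0F = refl
  adj 3F 1F = refl
  adj 3F 2F = refl
  adj 3F 3F = refl
  adj 3F (suc (suc (suc (suc j)))) = refl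
  adj (suc (suc (suc (suc i)))) 0F = refl
  adj (suc (suc (suc (suc i)))) 1F = refl
  adj (suc (suc (suc (suc i)))) 2F = refl
  adj (suc (suc (suc (suc i)))) 3F = refl
  adj (suc (suc (suc (suc i)))) (suc (suc (suc (suc j)))) = refl

pendants : ∀ {m} a → Legs m → Legs (a + m)
pendants zero    L = L
pendants (suc a) L = pendant (pendants a L)

pairs : ∀ {m} → Bool → ∀ b → Legs m → Legs (b * 2 + m)
pairs t zero    L = L
pairs t (suc b) L = pair t (pairs t b L)

pairs-cong : ∀ {m n} t b {L : Legs m} {M : Legs n} → LegsIso L M → LegsIso (pairs t b L) (pairs t b M)
pairs-cong t zero    i = i
pairs-cong t (suc b) i = pair-cong t (pairs-cong t b i)

pendant-pairs : ∀ {m} t b (L : Legs m) → LegsIso (pendant (pairs t b L)) (pairs t b (pendant L))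
pendant-pairs t zero    L = legs-refl
pendant-pairs t (suc b) L = legs-trans (swap-pendant-pair t (pairs t b L)) (pair-cong t (pendant-pairs t b L))

pair-pairs : ∀ {m} t u b (L : Legs m) → LegsIso (pair t (pairs u b L)) (pairs u b (pair t L))
pair-pairs t u zero    L = legs-refl
pair-pairs t u (suc b) L = legs-trans (swap-pairs t u (pairs u b L)) (pair-cong u (pair-pairs t u b L))

#pendants #edges #triangles : ∀ {m} → Legs m → ℕ
#pendants  []             = 0
#pendants  (pendant L)    = suc (#pendants L)
#pendants  (pair _ L)     = #pendants L
#edges     []             = 0
#edges     (pendant L)    = #edges L
#edges     (pair false L) = suc (#edges L)
#edges     (pair true L)  = #edges L
#triangles []             = 0
#triangles (pendant L)    = #triangles L
#triangles (pair false L) = #triangles L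
#triangles (pair true L)  = suc (#triangles L)

standard : ∀ c b a → Legs (c * 2 + (b * 2 + (a + 0)))
standard c b a = pairs true c (pairs false b (pendants a []))

-- Insertion sort: the remaining legs are sorted first, then the front leg is moved past those that
-- precede its kind.
legs-standard : ∀ {m} (L : Legs m) → LegsIso L (standard (#triangles L) (#edges L) (#pendants L))
legs-standard [] = legs-refl
legs-standard (pendant L) = legs-trans (pendant-cong (legs-standard L))
  (legs-trans (pendant-pairs true (#triangles L) _) (pairs-cong true (#triangles L) (pendant-pairs false (#edges L) _)))
legs-standard (pair false L) = legs-trans (pair-cong false (legs-standard L)) (pair-pairs false true (#triangles L) _)
legs-standard (pair true L) = pair-cong true (legs-standard L)

-- `standard` puts pendants last, whereas the join defining `T` lists its singletons first.
pairs-pendants : ∀ {m} b a (L : Legs m) → LegsIso (pairs false b (pendants a L)) (pendants a (pairs false b L))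
pairs-pendants b zero    L = legs-refl
pairs-pendants b (suc a) L =
    legs-trans (legs-sym (pendant-pairs false b (pendants a L))) (pendant-cong (pairs-pendants b a L))
  where
  legs-sym : ∀ {m n} {L : Legs m} {M : Legs n} → LegsIso L M → LegsIso M L
  legs-sym {L = L} {M} (legsIso σ links adj) = legsIso (flip σ)
    (λ i → sym (trans (links _) (cong (linked M) (inverseʳ σ))))
    (λ i j → sym (trans (adj _ _) (cong₂ (legG M) (inverseʳ σ) (inverseʳ σ))))

-- The stars as joins

-- In K_r * H the centre is joined to just one vertex of each component of H, so triangle legs
-- cannot come from components.
Plain : ∀ {m} → Legs m → Set
Plain []             = ⊤
Plain (pendant L)    = Plain L
Plain (pair false L) = Plain L
Plain (pair true L)  = ⊥

sizes : ∀ {m} → Legs m → List ℕ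
sizes []          = []
sizes (pendant L) = 1 ∷ sizes L
sizes (pair _ L)  = 2 ∷ sizes L

block : ∀ {m} → Legs m → Fin m → ℕ
block (pendant L) zero          = 0
block (pendant L) (suc i)       = suc (block L i)
block (pair t L)  zero          = 0
block (pair t L)  (suc zero)    = 0
block (pair t L)  (suc (suc i)) = suc (block L i)

blockOf-sizes : ∀ {m} (L : Legs m) → Plain L → ∀ i → blockOf (sizes L) (toℕ i) ≡ just (block L i , linked L i)
blockOf-sizes (pendant L)    pl zero          = refl
blockOf-sizes (pendant L)    pl (suc i)       rewrite blockOf-sizes L pl i = refl
blockOf-sizes (pair false L) pl zero          = refl
blockOf-sizes (pair false L) pl (suc zero)    = refl
blockOf-sizes (pair false L) pl (suc (suc i)) rewrite blockOf-sizes L pl i = refl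

legG-block : ∀ {m} (L : Legs m) i j → legG L i j ≡ not (toℕ i ≡ᵇ toℕ j) ∧ (block L i ≡ᵇ block L j)
legG-block (pendant L) zero          zero          = refl
legG-block (pendant L) zero          (suc j)       = refl
legG-block (pendant L) (suc i)       zero          = refl
legG-block (pendant L) (suc i)       (suc j)       = legG-block L i j
legG-block (pair t L)  zero          zero          = refl
legG-block (pair t L)  zero          (suc zero)    = refl
legG-block (pair t L)  zero          (suc (suc j)) = refl
legG-block (pair t L)  (suc zero)    zero          = refl
legG-block (pair t L)  (suc zero)    (suc zero)    = refl
legG-block (pair t L)  (suc zero)    (suc (suc j)) = refl
legG-block (pair t L)  (suc (suc i)) zero          = refl
legG-block (pair t L)  (suc (suc i)) (suc zero)    = refl
legG-block (pair t L)  (suc (suc i)) (suc (suc j)) = legG-block L i j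

same-iso : ∀ {n} {G H : Graph n} → (∀ i j → G i j ≡ H i j) → Iso G H
same-iso = iso idₚ

-- Here the centre alone is the K_r. In the next two lemmas the first leg completes it to K_2 or
-- K_3. The numberings agree, so the identity is an isomorphism.
star-join₁ : ∀ {m} (L : Legs m) → Plain L → Iso (starG L) (join (suc m) 1 (sizes L))
star-join₁ {m} L pl = same-iso eq
  where
  eq : ∀ i j → starG L i j ≡ join (suc m) 1 (sizes L) i j
  eq zero    zero    = refl
  eq zero    (suc j) rewrite blockOf-sizes L pl j = sym (Bool.∨-identityʳ (linked L j))
  eq (suc i) zero    rewrite blockOf-sizes L pl i = refl
  eq (suc i) (suc j)
    rewrite blockOf-sizes L pl i | blockOf-sizes L pl j | Bool.∨-identityʳ (block L i ≡ᵇ block L j) = legG-block L i j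

star-join₂ : ∀ {m} (L : Legs m) → Plain L → Iso (starG (pendant L)) (join (2 + m) 2 (sizes L))
star-join₂ {m} L pl = same-iso eq
  where
  eq : ∀ i j → starG (pendant L) i j ≡ join (2 + m) 2 (sizes L) i j
  eq 0F 0F = refl
  eq 0F 1F = refl
  eq 0F (suc (suc j)) rewrite blockOf-sizes L pl j = sym (Bool.∨-identityʳ (linked L j))
  eq 1F 0F = refl
  eq 1F 1F = refl
  eq 1F (suc (suc j)) = refl
  eq (suc (suc i)) 0F rewrite blockOf-sizes L pl i = refl
  eq (suc (suc i)) 1F = refl
  eq (suc (suc i)) (suc (suc j))
    rewrite blockOf-sizes L pl i | blockOf-sizes L pl j | Bool.∨-identityʳ (block L i ≡ᵇ block L j) = legG-block L i j

star-join₃ : ∀ {m} (L : Legs m) → Plain L → Iso (starG (pair true L)) (join (3 + m) 3 (sizes L))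
star-join₃ {m} L pl = same-iso eq
  where
  eq : ∀ i j → starG (pair true L) i j ≡ join (3 + m) 3 (sizes L) i j
  eq 0F 0F = refl
  eq 0F 1F = refl
  eq 0F 2F = refl
  eq 0F (suc (suc (suc j))) rewrite blockOf-sizes L pl j = sym (Bool.∨-identityʳ (linked L j))
  eq 1F 0F = refl
  eq 1F 1F = refl
  eq 1F 2F = refl
  eq 1F (suc (suc (suc j))) = refl
  eq 2F 0F = refl
  eq 2F 1F = refl
  eq 2F 2F = refl
  eq 2F (suc (suc (suc j))) = refl
  eq (suc (suc (suc i))) 0F rewrite blockOf-sizes L pl i = refl
  eq (suc (suc (suc i))) 1F = refl
  eq (suc (suc (suc i))) 2F = refl
  eq (suc (suc (suc i))) (suc (suc (suc j)))
    rewrite blockOf-sizes L pl i | blockOf-sizes L pl j | Bool.∨-identityʳ (block L i ≡ᵇ block L j) = legG-block L i j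

plain-pendants : ∀ {m} a {L : Legs m} → Plain L → Plain (pendants a L)
plain-pendants zero    pl = pl
plain-pendants (suc a) pl = plain-pendants a pl

plain-pairs : ∀ {m} b {L : Legs m} → Plain L → Plain (pairs false b L)
plain-pairs zero    pl = pl
plain-pairs (suc b) pl = plain-pairs b pl

sizes-pendants : ∀ {m} a (L : Legs m) → sizes (pendants a L) ≡ replicate a 1 ++ sizes L
sizes-pendants zero    L = refl
sizes-pendants (suc a) L = cong (1 ∷_) (sizes-pendants a L)

sizes-pairs : ∀ {m} b (L : Legs m) → sizes (pairs false b L) ≡ replicate b 2 ++ sizes L
sizes-pairs zero    L = refl
sizes-pairs (suc b) L = cong (2 ∷_) (sizes-pairs b L)

-- The values of d on stars

-- With no further neighbour of the centre allowed, only the far ends of the edge legs remain free.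
count-true : ∀ {m} (L : Legs m) → count true L ≡ 2 ^ #edges L
count-true []             = refl
count-true (pendant L)    = count-true L
count-true (pair true L)  = count-true L
count-true (pair false L) rewrite count-true L = cong (2 ^ #edges L +_) (sym (ℕ.+-identityʳ _))

#rest : ∀ {m} → Legs m → ℕ
#rest L = #pendants L + #triangles L * 2

#rest+edges : ∀ {m} (L : Legs m) → #rest L + #edges L * 2 ≡ m
#rest+edges []             = refl
#rest+edges (pendant L)    = cong suc (#rest+edges L)
#rest+edges (pair true L)  = trans (lemma (#pendants L) (#triangles L) (#edges L)) (cong (2 +_) (#rest+edges L))
  where
  lemma : ∀ a c b → a + (2 + c * 2) + b * 2 ≡ 2 + (a + c * 2 + b * 2)
  lemma = solve-∀
#rest+edges (pair false L) = trans (lemma (#pendants L) (#triangles L) (#edges L)) (cong (2 +_) (#rest+edges L))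
  where
  lemma : ∀ a c b → a + c * 2 + (2 + b * 2) ≡ 2 + (a + c * 2 + b * 2)
  lemma = solve-∀

-- Let b be the number of edge legs and r that of the other leg vertices, all linked to the centre.
-- No chosen neighbour of the centre gives 2^b sets, one among the r vertices gives r 2^b, and one
-- on an edge leg gives b 2^(b-1). A triangle thus counts like two pendants, which is why `U` and
-- `T` tie.
count-false : ∀ {m} (L : Legs m) → 2 * count false L ≡ 2 ^ #edges L * (2 + 2 * #rest L + #edges L)
count-false [] = refl
count-false (pendant L) rewrite count-true L = trans (ℕ.*-distribˡ-+ 2 (count false L) _)
  (trans (cong (_+ 2 * 2 ^ #edges L) (count-false L)) (lemma (2 ^ #edges L) (#rest L) (#edges L)))
  where
  lemma : ∀ p r b → p * (2 + 2 * r + b) + 2 * p ≡ p * (2 + 2 * (1 + r) + b)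
  lemma = solve-∀
count-false (pair true L) rewrite count-true L = trans (split (count false L) (2 ^ #edges L))
  (trans (cong (_+ 4 * 2 ^ #edges L) (count-false L)) (lemma (2 ^ #edges L) (#pendants L) (#triangles L) (#edges L)))
  where
  split : ∀ x p → 2 * (x + p + p) ≡ 2 * x + 4 * p
  split = solve-∀
  lemma : ∀ p a c b → p * (2 + 2 * (a + c * 2) + b) + 4 * p ≡ p * (2 + 2 * (a + (2 + c * 2)) + b)
  lemma = solve-∀
count-false (pair false L) rewrite count-true L = trans (split (count false L) (2 ^ #edges L))
  (trans (cong (λ x → 2 * x + 2 * 2 ^ #edges L) (count-false L)) (lemma (2 ^ #edges L) (#rest L) (#edges L)))
  where
  split : ∀ x p → 2 * (x + x + p) ≡ 2 * (2 * x) + 2 * p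
  split = solve-∀
  lemma : ∀ p r b → 2 * (p * (2 + 2 * r + b)) + 2 * p ≡ (2 * p) * (2 + 2 * r + (1 + b))
  lemma = solve-∀

-- h (9 + ε + 2 k) = 2 ^ (8 + ε + 2 k) + excess ε k for ε = 0 and ε = 1.
excess : ℕ → ℕ → ℕ
excess ε k = (18 + ε * 4 + k * 2) * 2 ^ (1 + k)

count-second : ∀ ε k {m} (L : Legs m) → m ≡ 8 + ε + k * 2 → #edges L ≡ 3 + k → count false L ≡ excess ε k
count-second ε k L order b≡ = ℕ.*-cancelˡ-≡ _ _ 2 (begin
  2 * count false L                              ≡⟨ count-false L ⟩
  2 ^ #edges L * (2 + 2 * #rest L + #edges L)    ≡⟨ cong₂ (λ b r → 2 ^ b * (2 + 2 * r + b)) b≡ r≡ ⟩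
  2 ^ (3 + k) * (2 + 2 * (2 + ε) + (3 + k))      ≡⟨ lemma ε k (2 ^ k) ⟩
  2 * excess ε k                                 ∎)
  where
  open ≡-Reasoning
  shift : ∀ ε k → 8 + ε + k * 2 ≡ 2 + ε + (3 + k) * 2
  shift = solve-∀
  r≡ : #rest L ≡ 2 + ε
  r≡ = ℕ.+-cancelʳ-≡ ((3 + k) * 2) _ _
      (trans (cong (λ b → #rest L + b * 2) (sym b≡)) (trans (#rest+edges L) (trans order (shift ε k))))
  lemma : ∀ ε k p → 2 * (2 * (2 * p)) * (2 + 2 * (2 + ε) + (3 + k)) ≡ 2 * ((18 + ε * 4 + k * 2) * (2 * p))
  lemma = solve-∀

1+n≤2^n : ∀ n → 1 + n ≤ 2 ^ n
1+n≤2^n zero    = s≤s z≤n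
1+n≤2^n (suc n) = ℕ.+-mono-≤ (ℕ.m^n>0 2 n) (ℕ.≤-trans (1+n≤2^n n) (ℕ.m≤m+n (2 ^ n) 0))

-- Here `s` measures how far the number of edge legs falls below 2 + k. The bracket gains only a
-- linear term in `s`, while the power of two loses the factor 2 ^ s, which is at least 1 + s.
count-few-edges : ∀ ε k s {m} (L : Legs m) → m ≡ 8 + ε + k * 2 → 2 + k ≡ #edges L + s → count false L < excess ε k
count-few-edges ε k s L order k≡ = ℕ.*-cancelˡ-< 2 _ _ (begin-strict
  2 * count false L                                       ≡⟨ count-false L ⟩
  2 ^ b * (2 + 2 * #rest L + b)                           ≡⟨ cong (λ r → 2 ^ b * (2 + 2 * r + b)) r≡ ⟩
  2 ^ b * (2 + 2 * (4 + ε + s * 2) + b)                   <⟨ ℕ.*-monoʳ-< (2 ^ b) {{ℕ.m^n≢0 2 b}} inner ⟩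
  2 ^ b * ((1 + s) * (14 + ε * 4 + (b + s) * 2))          ≤⟨ ℕ.*-monoʳ-≤ (2 ^ b) (ℕ.*-monoˡ-≤ _ (1+n≤2^n s)) ⟩
  2 ^ b * (2 ^ s * (14 + ε * 4 + (b + s) * 2))            ≡⟨ ℕ.*-assoc (2 ^ b) (2 ^ s) _ ⟨
  2 ^ b * 2 ^ s * (14 + ε * 4 + (b + s) * 2)              ≡⟨ cong (_* (14 + ε * 4 + (b + s) * 2))
      (ℕ.^-distribˡ-+-* 2 b s) ⟨
  2 ^ (b + s) * (14 + ε * 4 + (b + s) * 2)                ≡⟨ cong (λ x → 2 ^ x * (14 + ε * 4 + x * 2)) k≡ ⟨
  2 ^ (2 + k) * (14 + ε * 4 + (2 + k) * 2)                ≡⟨ last ε k (2 ^ k) ⟩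
  2 * excess ε k                                          ∎)
  where
  open ℕ.≤-Reasoning
  b = #edges L
  shift : ∀ ε k → 8 + ε + k * 2 ≡ 4 + ε + (2 + k) * 2
  shift = solve-∀
  shift' : ∀ ε b s → 4 + ε + (b + s) * 2 ≡ (4 + ε + s * 2) + b * 2
  shift' = solve-∀
  r≡ : #rest L ≡ 4 + ε + s * 2
  r≡ = ℕ.+-cancelʳ-≡ (b * 2) _ _
      (trans (#rest+edges L) (trans order (trans (shift ε k) (trans (cong (λ x → 4 + ε + x * 2) k≡) (shift' ε b s)))))
  -- The difference of the two sides as an explicit polynomial with natural coefficients.
  slack : ∀ ε b s → suc (2 + 2 * (4 + ε + s * 2) + b) +
      (3 + 2 * ε + b + 12 * s + ε * 4 * s + s * b * 2 + s * s * 2) ≡ (1 + s) * (14 + ε * 4 + (b + s) * 2)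
  slack = solve-∀
  inner : 2 + 2 * (4 + ε + s * 2) + b < (1 + s) * (14 + ε * 4 + (b + s) * 2)
  inner = subst (2 + 2 * (4 + ε + s * 2) + b <_) (slack ε b s) (ℕ.m≤m+n _ _)
  last : ∀ ε k p → 2 * (2 * p) * (14 + ε * 4 + (2 + k) * 2) ≡ 2 * ((18 + ε * 4 + k * 2) * (2 * p))
  last = solve-∀

data EdgeCount (ε k : ℕ) {m} (L : Legs m) : Set where
  max    : #edges L ≡ 4 + k → #rest L ≡ ε → EdgeCount ε k L
  second : #edges L ≡ 3 + k → #rest L ≡ 2 + ε → EdgeCount ε k L
  few    : ∀ s → 2 + k ≡ #edges L + s → EdgeCount ε k L

edgeCount : ∀ ε k {m} (L : Legs m) → ε ≤ 1 → m ≡ 8 + ε + k * 2 → EdgeCount ε k L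
edgeCount ε k L ε≤1 order with #edges L ≤? 2 + k
... | yes b≤ = few (2 + k ∸ #edges L) (sym (ℕ.m+[n∸m]≡n b≤))
... | no b≰ with #edges L ≤? 3 + k
...   | yes b≤ = second b≡
    (ℕ.+-cancelʳ-≡ ((3 + k) * 2) _ _
        (trans (cong (λ b → #rest L + b * 2) (sym b≡)) (trans (#rest+edges L) (trans order (shift ε k)))))
  where
  b≡ = ℕ.≤-antisym b≤ (ℕ.≰⇒> b≰)
  shift : ∀ ε k → 8 + ε + k * 2 ≡ 2 + ε + (3 + k) * 2
  shift = solve-∀
...   | no b≰' = max b≡
    (ℕ.+-cancelʳ-≡ ((4 + k) * 2) _ _
        (trans (cong (λ b → #rest L + b * 2) (sym b≡)) (trans (#rest+edges L) (trans order (shift ε k)))))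
  where
  shift : ∀ ε k → 8 + ε + k * 2 ≡ ε + (4 + k) * 2
  shift = solve-∀
  b≡ : #edges L ≡ 4 + k
  -- Five + k edge legs would already take up 10 + 2 k vertices, while there are at most 9 + 2 k.
  b≡ = ℕ.≤-antisym (ℕ.≮⇒≥ λ 5+k≤b → ℕ.1+n≰n (begin
    10 + k * 2                ≤⟨ ℕ.*-monoˡ-≤ 2 5+k≤b ⟩
    #edges L * 2              ≤⟨ ℕ.m≤n+m _ (#rest L) ⟩
    #rest L + #edges L * 2    ≡⟨ trans (#rest+edges L) order ⟩
    8 + ε + k * 2             ≤⟨ ℕ.+-monoˡ-≤ (k * 2) (ℕ.+-monoʳ-≤ 8 ε≤1) ⟩
    9 + k * 2                 ∎)) (ℕ.≰⇒> b≰')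
    where open ℕ.≤-Reasoning

-- The value `h` and the graphs `F`, `U`, `T` by parity.

isOdd-odd : ∀ k → isOdd (9 + k * 2) ≡ true
isOdd-odd k = cong (_≡ᵇ 1) ([m+kn]%n≡m%n 9 k 2)

isOdd-even : ∀ k → isOdd (10 + k * 2) ≡ false
isOdd-even k = cong (_≡ᵇ 1) ([m+kn]%n≡m%n 10 k 2)

half-even : ∀ k → k * 2 / 2 ≡ k
half-even k = m*n/n≡m k 2

half-odd : ∀ k → (1 + k * 2) / 2 ≡ k
half-odd k = trans (+-distrib-/-∣ʳ 1 {k * 2} {2} (divides-refl k)) (half-even k)

if-true : ∀ {A : Set} {b} {x y : A} → b ≡ true → (if b then x else y) ≡ x
if-true refl = refl

if-false : ∀ {A : Set} {b} {x y : A} → b ≡ false → (if b then x else y) ≡ y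
if-false refl = refl

-- With the numeral first in the order, the truncated subtraction reduces by computation and leaves
-- `(1 + k) * 2 / 2`.
h-odd : ∀ k → h (9 + k * 2) ≡ 2 ^ (8 + k * 2) + excess 0 k
h-odd k = trans (if-true (isOdd-odd k))
    (cong₂ (λ x e → 2 ^ (8 + k * 2) + x * 2 ^ e) (ℕ.+-comm (9 + k * 2) 9) (half-even (1 + k)))

h-even : ∀ k → h (10 + k * 2) ≡ 2 ^ (9 + k * 2) + excess 1 k
h-even k = trans (if-false (isOdd-even k))
    (cong₂ (λ x e → 2 ^ (9 + k * 2) + x * 2 ^ e) (ℕ.+-comm (10 + k * 2) 12) (half-even (1 + k)))

sizes-standard₀ : ∀ a b → sizes (pendants a (pairs false b [])) ≡ replicate a 1 ++ replicate b 2
sizes-standard₀ a b = trans (sizes-pendants a _) (cong (replicate a 1 ++_) (trans (sizes-pairs b []) (++-identityʳ _)))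

plain-standard₀ : ∀ a b → Plain (pendants a (pairs false b []))
plain-standard₀ a b = plain-pendants a (plain-pairs b tt)

order₀ : ∀ a b → suc (a + (b * 2 + 0)) ≡ 1 + a + b * 2
order₀ a b = cong (λ x → suc (a + x)) (ℕ.+-identityʳ _)

standard-join₁ : ∀ a b → Iso (starG (standard 0 b a)) (join (1 + a + b * 2) 1 (replicate a 1 ++ replicate b 2))
standard-join₁ a b = iso-trans (legs⇒star (pairs-pendants b a []))
  (go (order₀ a b) (sizes-standard₀ a b))
  where
  -- Order and block list are generalised so that both equations can be matched with `refl`.
  go : ∀ {n cs} → suc (a + (b * 2 + 0)) ≡ n → sizes (pendants a (pairs false b [])) ≡ cs →
      Iso (starG (pendants a (pairs false b []))) (join n 1 cs)
  go refl refl = star-join₁ _ (plain-standard₀ a b)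

standard-join₂ : ∀ b → Iso (starG (standard 0 b 1)) (join (2 + b * 2) 2 (replicate b 2))
standard-join₂ b = iso-trans (legs⇒star (pairs-pendants b 1 []))
  (go (order₀ 1 b) (sizes-standard₀ 0 b))
  where
  go : ∀ {n cs} → 2 + (b * 2 + 0) ≡ n → sizes (pairs false b []) ≡ cs →
      Iso (starG (pendant pairs false b [])) (join n 2 cs)
  go refl refl = star-join₂ _ (plain-standard₀ 0 b)

standard-join₃ : ∀ a b → Iso (starG (standard 1 b a)) (join (3 + a + b * 2) 3 (replicate b 2 ++ replicate a 1))
standard-join₃ a b = go (order a b)
    (trans (sizes-pairs b _) (cong (replicate b 2 ++_) (trans (sizes-pendants a []) (++-identityʳ _))))
  where
  order : ∀ a b → 3 + (b * 2 + (a + 0)) ≡ 3 + a + b * 2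
  order = solve-∀
  go : ∀ {n cs} → 3 + (b * 2 + (a + 0)) ≡ n → sizes (pairs false b (pendants a [])) ≡ cs →
      Iso (starG (standard 1 b a)) (join n 3 cs)
  go refl refl = star-join₃ _ (plain-pairs b (plain-pendants a tt))

F-odd : ∀ k → F (9 + k * 2) ≡ join (9 + k * 2) 1 (replicate (4 + k) 2)
F-odd k = trans (if-true (isOdd-odd k)) (cong (λ q → join (9 + k * 2) 1 (replicate q 2)) (half-even (4 + k)))

F-even : ∀ k → F (10 + k * 2) ≡ join (10 + k * 2) 2 (replicate (4 + k) 2)
F-even k = trans (if-false (isOdd-even k)) (cong (λ q → join (10 + k * 2) 2 (replicate q 2)) (half-even (4 + k)))

T-odd : ∀ k → T (9 + k * 2) ≡ join (9 + k * 2) 1 (replicate 2 1 ++ replicate (3 + k) 2)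
T-odd k = trans (if-true (isOdd-odd k))
    (cong (λ q → join (9 + k * 2) 1 (replicate 2 1 ++ replicate q 2)) (half-even (3 + k)))

T-even : ∀ k → T (10 + k * 2) ≡ join (10 + k * 2) 1 (replicate 3 1 ++ replicate (3 + k) 2)
T-even k = trans (if-false (isOdd-even k))
    (cong (λ q → join (10 + k * 2) 1 (replicate 3 1 ++ replicate q 2)) (half-even (3 + k)))

U-odd : ∀ k → U (9 + k * 2) ≡ join (9 + k * 2) 3 (replicate (3 + k) 2 ++ replicate 0 1)
U-odd k = cong₂ (λ q r → join (9 + k * 2) 3 (replicate q 2 ++ replicate r 1)) (half-even (3 + k))
  (trans (cong (_% 2) (ℕ.+-comm (9 + k * 2) 1)) (m*n%n≡0 (5 + k) 2))

U-even : ∀ k → U (10 + k * 2) ≡ join (10 + k * 2) 3 (replicate (3 + k) 2 ++ replicate 1 1)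
U-even k = cong₂ (λ q r → join (10 + k * 2) 3 (replicate q 2 ++ replicate r 1)) (half-odd (3 + k))
  (trans (cong (_% 2) (ℕ.+-comm (10 + k * 2) 1)) ([m+kn]%n≡m%n 11 k 2))

-- n = 9 + ε + 2 k, with F n, U n and T n identified as standard stars.
record Extremal (n ε k : ℕ) : Set where
  constructor mkExtremal
  field
    n≡   : n ≡ 9 + ε + k * 2
    h≡   : h n ≡ 2 ^ (8 + ε + k * 2) + excess ε k
    isoF : Iso (starG (standard 0 (4 + k) ε)) (F n)
    isoU : Iso (starG (standard 1 (3 + k) ε)) (U n)
    isoT : Iso (starG (standard 0 (3 + k) (2 + ε))) (T n)

extremal-odd : ∀ k → Extremal (9 + k * 2) 0 k
extremal-odd k = mkExtremal refl (h-odd k)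
  (subst (Iso (starG (standard 0 (4 + k) 0))) (sym (F-odd k)) (standard-join₁ 0 (4 + k)))
  (subst (Iso (starG (standard 1 (3 + k) 0))) (sym (U-odd k)) (standard-join₃ 0 (3 + k)))
  (subst (Iso (starG (standard 0 (3 + k) 2))) (sym (T-odd k)) (standard-join₁ 2 (3 + k)))

extremal-even : ∀ k → Extremal (10 + k * 2) 1 k
extremal-even k = mkExtremal refl (h-even k)
  (subst (Iso (starG (standard 0 (4 + k) 1))) (sym (F-even k)) (standard-join₂ (4 + k)))
  (subst (Iso (starG (standard 1 (3 + k) 1))) (sym (U-even k)) (standard-join₃ 1 (3 + k)))
  (subst (Iso (starG (standard 0 (3 + k) 3))) (sym (T-even k)) (standard-join₁ 3 (3 + k)))

extremal : ∀ n → 9 ≤ n → ∃₂ λ ε k → ε ≤ 1 × Extremal n ε k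
extremal n 9≤n with parity (n ∸ 9)
  where
  parity : ∀ j → ∃ λ k → j ≡ k * 2 ⊎ j ≡ 1 + k * 2
  parity zero = 0 , inj₁ refl
  parity (suc j) with parity j
  ... | k , inj₁ refl = k , inj₂ refl
  ... | k , inj₂ refl = suc k , inj₁ refl
... | k , inj₁ eq with refl ← trans (sym (ℕ.m+[n∸m]≡n 9≤n)) (cong (9 +_) eq) = 0 , k , z≤n , extremal-odd k
... | k , inj₂ eq with refl ← trans (sym (ℕ.m+[n∸m]≡n 9≤n)) (cong (9 +_) eq) = 1 , k , s≤s z≤n , extremal-even k

#edges-pairs : ∀ {m} b (L : Legs m) → #edges (pairs false b L) ≡ b + #edges L
#edges-pairs zero    L = refl
#edges-pairs (suc b) L = cong suc (#edges-pairs b L)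

#edges-pairs-true : ∀ {m} c (L : Legs m) → #edges (pairs true c L) ≡ #edges L
#edges-pairs-true zero    L = refl
#edges-pairs-true (suc c) L = #edges-pairs-true c L

#edges-pendants : ∀ {m} a (L : Legs m) → #edges (pendants a L) ≡ #edges L
#edges-pendants zero    L = refl
#edges-pendants (suc a) L = #edges-pendants a L

#edges-standard : ∀ c b a → #edges (standard c b a) ≡ b
#edges-standard c b a =
    trans (#edges-pairs-true c _)
        (trans (#edges-pairs b _) (trans (cong (b +_) (#edges-pendants a [])) (ℕ.+-identityʳ b)))

d-isoStar : ∀ {m n} {G : Graph n} (L : Legs m) → Iso (starG L) G → d G ≡ 2 ^ m + count false L
d-isoStar L i = trans (sym (d-iso i)) (d-star L)

-- The count depends only on the order and the number 3 + k of edge legs, so this covers `U` and `T`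
-- at once.
extremal-d : ∀ {n ε k c a} {G : Graph n} → Extremal n ε k → Iso (starG (standard c (3 + k) a)) G → d G ≡ h n
extremal-d {ε = ε} {k} {c} {a} (mkExtremal n≡ h≡ _ _ _) i = trans (d-isoStar (standard c (3 + k) a) i)
  (trans (cong₂ (λ m x → 2 ^ m + x) order
      (count-second ε k (standard c (3 + k) a) order (#edges-standard c (3 + k) a))) (sym h≡))
  where
  order = ℕ.suc-injective (trans (iso-order i) n≡)

-- Conclusion.

centre-cases : ∀ {n} {G : Graph n} {c} → 9 ≤ n → IsSimple G → Connected G → IsCentre G c → ¬ (G ≅ F n) →
  d G < h n ⊎ (G ≅ U n ⊎ G ≅ T n)
centre-cases {n} {G} 9≤n simple conn centre ¬F
  with ε , k , ε≤1 , mkExtremal n≡ h≡ isoF isoU isoT ← extremal n 9≤n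
  with m , L , sm≡n , i ← centre⇒star simple conn centre = by (edgeCount ε k L ε≤1 order)
  where
  order = ℕ.suc-injective (trans sm≡n n≡)
  std : ∀ {c b a} → #triangles L ≡ c → #edges L ≡ b → #pendants L ≡ a → ∀ {H : Graph n} →
      Iso (starG (standard c b a)) H → G ≅ H
  std refl refl refl j = iso⇒≅ (iso-trans (iso-sym i) (iso-trans (legs⇒star (legs-standard L)) j))
  by : EdgeCount ε k L → d G < h n ⊎ (G ≅ U n ⊎ G ≅ T n)
  by (few s k≡) = inj₁ (begin-strict
    d G                            ≡⟨ d-isoStar L i ⟩
    2 ^ m + count false L          <⟨ ℕ.+-monoʳ-< (2 ^ m) (count-few-edges ε k s L order k≡) ⟩
    2 ^ m + excess ε k             ≡⟨ cong (λ m → 2 ^ m + excess ε k) order ⟩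
    2 ^ (8 + ε + k * 2) + excess ε k ≡⟨ h≡ ⟨
    h n                            ∎)
    where open ℕ.≤-Reasoning
  -- The remaining 2 + ε leg vertices are at most three, so there is no triangle, giving `T`, or
  -- one, giving `U`.
  by (second b≡ r≡) with #triangles L in c≡
  ... | zero        = inj₂ (inj₂ (std c≡ b≡ (trans (sym (ℕ.+-identityʳ _)) r≡) isoT))
  ... | suc zero    = inj₂ (inj₁ (std c≡ b≡ (ℕ.+-cancelʳ-≡ 2 _ _ (trans r≡ (ℕ.+-comm 2 ε))) isoU))
  ... | suc (suc c) = ⊥-elim
      (ℕ.<⇒≱ {2 + ε} {4} (s≤s (s≤s (s≤s ε≤1)))
          (ℕ.≤-trans (ℕ.m≤m+n 4 (c * 2)) (ℕ.≤-trans (ℕ.m≤n+m _ (#pendants L)) (ℕ.≤-reflexive r≡))))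
  -- Only ε vertices remain, too few for a triangle, and so the star is the excluded `F`.
  by (max b≡ r≡) with #triangles L in c≡
  ... | zero        = ⊥-elim (¬F (std c≡ b≡ (trans (sym (ℕ.+-identityʳ _)) r≡) isoF))
  ... | suc c       = ⊥-elim
      (ℕ.<⇒≱ {ε} {2} (s≤s ε≤1) (ℕ.≤-trans (ℕ.m≤m+n 2 (c * 2)) (ℕ.≤-trans (ℕ.m≤n+m _ (#pendants L)) (ℕ.≤-reflexive r≡))))

dichotomy : ∀ {n} {G : Graph n} → 9 ≤ n → IsSimple G → Connected G → ¬ (G ≅ F n) → d G < h n ⊎ (G ≅ U n ⊎ G ≅ T n)
dichotomy 9≤n simple conn ¬F with centre-or-disjointP₃s 9≤n simple conn
... | inj₁ (c , centre) = centre-cases 9≤n simple conn centre ¬F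
... | inj₂ disj         = inj₁ (disjointP₃s⇒d<h 9≤n simple conn disj)

theorem3p3 : (n : ℕ) → 9 ≤ n → (G : Graph n) → IsSimple G → Connected G →
    ¬ (G ≅ F n) →
    d G ≤ h n × (d G ≡ h n ⇔ ((G ≅ U n) ⊎ (G ≅ T n)))
theorem3p3 n 9≤n G simple conn ¬F with extremal n 9≤n
... | ε , k , _ , ext@(mkExtremal _ _ _ isoU isoT) = conclude (dichotomy 9≤n simple conn ¬F)
  where
  attains : (G ≅ U n) ⊎ (G ≅ T n) → d G ≡ h n
  attains (inj₁ i) = trans (d-iso (≅⇒iso i)) (extremal-d {c = 1} {a = ε} ext isoU)
  attains (inj₂ i) = trans (d-iso (≅⇒iso i)) (extremal-d {c = 0} {a = 2 + ε} ext isoT)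
  conclude : d G < h n ⊎ (G ≅ U n ⊎ G ≅ T n) → d G ≤ h n × (d G ≡ h n ⇔ ((G ≅ U n) ⊎ (G ≅ T n)))
  conclude (inj₁ d<h) = ℕ.<⇒≤ d<h , mk⇔ (λ d≡h → ⊥-elim (ℕ.<⇒≢ d<h d≡h)) attains
  conclude (inj₂ i)   = ℕ.≤-reflexive (attains i) , mk⇔ (λ _ → i) attains
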